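{- For integers $d\ge 1$ and $N\ge 1$, let $H_d(N)$ be the number of tuples $(a_0,a_1,\ldots,a_d)$ of integers with $0\le a_0\le N$, $1\le a_i\le N$ for $i=1,\ldots,d$, and $H(a_0;a_1,\ldots,a_d)\subset\mathcal{S}$. Then $$N\log N\ll H_2(N)\ll N\log N,$$ i.e. there are constants $c_1,c_2>0$ with $c_1N\log N\le H_2(N)\le c_2N\log N$ for all sufficiently large $N$. Furthermore, for every $d$ and every $\varepsilon_d>0$, $$H_d(N)\ll_d N^{1+\varepsilon_d},$$ i.e. there is a constant $C$, depending only on $d$ and $\varepsilon_d$, with $H_d(N)\le C\,N^{1+\varepsilon_d}$ for all $N\ge 1$.
   Context: $\mathcal{S}=\{n^2 : n\in\mathbb{N}\}$ is the set of integer squares ($\mathbb{N}$ contains $0$). The Hilbert cube of dimension $d$ is $H(a_0;a_1,\ldots,a_d)=\{a_0+\sum_{i=1}^d\varepsilon_ia_i : \varepsilon_i\in\{0,1\}\}$. -}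

module Defs where

open import Algebra.Definitions.RawSemiring using () renaming (_^_ to pow)
open import Data.Fin using (Fin; zero; suc; toℕ)
open import Data.Integer as ℤ using (+_; +[1+_]; +≤+; +<+)
import Data.Integer.Properties as ℤ
open import Data.List as List using (List; []; _∷_; upTo; cartesianProduct; cartesianProductWith; filter; length)
open import Data.Nat as ℕ using (ℕ; zero; suc; NonZero)
import Data.Nat.Properties as ℕ
open import Data.Product using (∃; _×_; _,_; proj₁; proj₂)
open import Data.Rational hiding (NonZero)
open import Data.Rational.Properties
import Data.Rational.Unnormalised as ℚᵘ
import Data.Rational.Unnormalised.Properties as ℚᵘ
open import Data.Rational.Solver using (module +-*-Solver)
open import Data.Sum using ([_,_]′)
open import Data.Vec as Vec using (Vec; []; _∷_; zipWith)
open import Level using (0ℓ)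
open import Relation.Binary.PropositionalEquality
open import Relation.Nullary using (Dec)
open import Relation.Nullary.Decidable using (map′; _×-dec_)
open import Relation.Unary using (Pred; Decidable; _⊆_)

Squares : Pred ℕ 0ℓ
Squares m = ∃ λ n → m ≡ n ℕ.^ 2

HilbertCube : ∀ {d} → ℕ → Vec ℕ d → Pred ℕ 0ℓ
HilbertCube {d} a₀ a m =
  ∃ λ (ε : Vec (Fin 2) d) → m ≡ a₀ ℕ.+ Vec.sum (zipWith (λ εᵢ aᵢ → toℕ εᵢ ℕ.* aᵢ) ε a)

squares? : Decidable Squares
squares? m = map′ (λ (n , _ , eq) → n , eq) bounded (ℕ.anyUpTo? (λ n → m ℕ.≟ n ℕ.^ 2) (suc m))
  where
  bounded : Squares m → ∃ λ n → n ℕ.< suc m × m ≡ n ℕ.^ 2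
  bounded (zero  , eq) = zero , ℕ.z<s , eq
  bounded (suc n , eq) =
    suc n , ℕ.s≤s (subst (suc n ℕ.≤_) (sym eq) (ℕ.m≤m*n (suc n) (suc n ℕ.* 1))) , eq

allSubsets? : ∀ {d} {P : Pred (Vec (Fin 2) d) 0ℓ} → Decidable P → Dec (∀ ε → P ε)
allSubsets? {zero}  P? = map′ (λ { p [] → p }) (λ f → f []) (P? [])
allSubsets? {suc d} P? =
  map′ (λ { (p , q) (zero ∷ ε) → p ε ; (p , q) (suc zero ∷ ε) → q ε })
       (λ f → (λ ε → f (zero ∷ ε)) , (λ ε → f (suc zero ∷ ε)))
       (allSubsets? (λ ε → P? (zero ∷ ε)) ×-dec allSubsets? (λ ε → P? (suc zero ∷ ε)))

cube⊆squares? : ∀ {d} (t : ℕ × Vec ℕ d) → Dec (HilbertCube (proj₁ t) (proj₂ t) ⊆ Squares)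
cube⊆squares? (a₀ , a) =
  map′ (λ { f (ε , refl) → f ε }) (λ g ε → g (ε , refl)) (allSubsets? (λ ε → squares? _))

vectors : ∀ {A : Set} d → List A → List (Vec A d)
vectors zero    xs = [] ∷ []
vectors (suc d) xs = cartesianProductWith _∷_ xs (vectors d xs)

-- The bounds 0 ≤ a₀ and 1 ≤ aᵢ make every entry of a tuple a natural number.
tuples : ∀ d → ℕ → List (ℕ × Vec ℕ d)
tuples d N = cartesianProduct (upTo (suc N)) (vectors d (List.map suc (upTo N)))

H : ℕ → ℕ → ℕ
H d N = length (filter cube⊆squares? (tuples d N))

-- Reals are Cauchy sequences of rationals, with the order relations on their limits.
record ℝ : Set where
  field
    seq    : ℕ → ℚ
    cauchy : ∀ δ → 0ℚ < δ → ∃ λ n₀ → ∀ m n → n₀ ℕ.≤ m → n₀ ℕ.≤ n → ∣ seq m - seq n ∣ < δ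
open ℝ public

infix 4 _≤ᴿ_ _<ᴿ_
infixl 6 _+ᴿ_
infixl 7 _*ᴿ_

_≤ᴿ_ : ℝ → ℝ → Set
x ≤ᴿ y = ∀ δ → 0ℚ < δ → ∃ λ n₀ → ∀ n → n₀ ℕ.≤ n → seq x n ≤ seq y n + δ

_<ᴿ_ : ℝ → ℝ → Set
x <ᴿ y = ∃ λ δ → 0ℚ < δ × ∃ λ n₀ → ∀ n → n₀ ℕ.≤ n → seq x n + δ ≤ seq y n

fromℚ : ℚ → ℝ
fromℚ q .seq _ = q
fromℚ q .cauchy δ 0<δ = 0 , λ _ _ _ _ → subst (λ r → ∣ r ∣ < δ) (sym (+-inverseʳ q)) 0<δ

ℕ→ℚ : ℕ → ℚ
ℕ→ℚ n = + n / 1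

fromℕ : ℕ → ℝ
fromℕ n = fromℚ (ℕ→ℚ n)

half : ∀ {δ} → 0ℚ < δ → 0ℚ < δ * ½
half {δ} 0<δ = positive⁻¹ _ {{pos*pos⇒pos δ {{positive 0<δ}} ½}}

halves : ∀ δ → δ * ½ + δ * ½ ≡ δ
halves δ = trans (sym (*-distribˡ-+ δ ½ ½)) (*-identityʳ δ)

∣p-q∣≡∣q-p∣ : ∀ p q → ∣ p - q ∣ ≡ ∣ q - p ∣
∣p-q∣≡∣q-p∣ p q = trans (cong ∣_∣ (solve 2 (λ p q → p :- q := :- (q :- p)) refl p q)) (∣-p∣≡∣p∣ (q - p))
  where open +-*-Solver

p≤q⇒0≤q-p : ∀ {p q} → p ≤ q → 0ℚ ≤ q - p
p≤q⇒0≤q-p {p} {q} p≤q = subst (_≤ q - p) (+-inverseʳ p) (+-monoˡ-≤ (- p) p≤q)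

open ≤-Reasoning

p≤p+q : ∀ p {q} → 0ℚ ≤ q → p ≤ p + q
p≤p+q p {q} 0≤q = begin
  p       ≡⟨ +-identityʳ p ⟨
  p + 0ℚ  ≤⟨ +-monoʳ-≤ p 0≤q ⟩
  p + q   ∎

_+ᴿ_ : ℝ → ℝ → ℝ
(x +ᴿ y) .seq n = seq x n + seq y n
(x +ᴿ y) .cauchy δ 0<δ = n₁ ℕ.⊔ n₂ , close
  where
  n₁ = proj₁ (cauchy x (δ * ½) (half 0<δ))
  n₂ = proj₁ (cauchy y (δ * ½) (half 0<δ))
  close : ∀ m n → n₁ ℕ.⊔ n₂ ℕ.≤ m → n₁ ℕ.⊔ n₂ ℕ.≤ n →
          ∣ (seq x m + seq y m) - (seq x n + seq y n) ∣ < δ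
  close m n m≥ n≥ = begin-strict
    ∣ (xm + ym) - (xn + yn) ∣    ≡⟨ cong ∣_∣ (solve 4 (λ a b c d → (a :+ b) :- (c :+ d) := (a :- c) :+ (b :- d)) refl xm ym xn yn) ⟩
    ∣ (xm - xn) + (ym - yn) ∣    ≤⟨ ∣p+q∣≤∣p∣+∣q∣ (xm - xn) (ym - yn) ⟩
    ∣ xm - xn ∣ + ∣ ym - yn ∣    <⟨ +-mono-<
      (proj₂ (cauchy x (δ * ½) (half 0<δ)) m n (ℕ.m⊔n≤o⇒m≤o n₁ n₂ m≥) (ℕ.m⊔n≤o⇒m≤o n₁ n₂ n≥))
      (proj₂ (cauchy y (δ * ½) (half 0<δ)) m n (ℕ.m⊔n≤o⇒n≤o n₁ n₂ m≥) (ℕ.m⊔n≤o⇒n≤o n₁ n₂ n≥)) ⟩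
    δ * ½ + δ * ½                ≡⟨ halves δ ⟩
    δ                            ∎
    where
    open +-*-Solver
    xm = seq x m ; xn = seq x n ; ym = seq y m ; yn = seq y n

bounded : (x : ℝ) → ∃ λ B → 0ℚ < B × ∃ λ n₀ → ∀ n → n₀ ℕ.≤ n → ∣ seq x n ∣ ≤ B
bounded x = ∣ seq x n₀ ∣ + 1ℚ , positive⁻¹ _ {{nonNeg+pos⇒pos ∣ seq x n₀ ∣ {{∣-∣-nonNeg (seq x n₀)}} 1ℚ}} , n₀ , bound
  where
  c = cauchy x 1ℚ (positive⁻¹ 1ℚ)
  n₀ = proj₁ c
  bound : ∀ n → n₀ ℕ.≤ n → ∣ seq x n ∣ ≤ ∣ seq x n₀ ∣ + 1ℚ
  bound n n≥ = begin
    ∣ xn ∣                ≡⟨ cong ∣_∣ (solve 2 (λ a b → a := b :+ (a :- b)) refl xn x₀) ⟩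
    ∣ x₀ + (xn - x₀) ∣    ≤⟨ ∣p+q∣≤∣p∣+∣q∣ x₀ (xn - x₀) ⟩
    ∣ x₀ ∣ + ∣ xn - x₀ ∣  ≤⟨ +-monoʳ-≤ ∣ x₀ ∣ (<⇒≤ (proj₂ c n n₀ n≥ ℕ.≤-refl)) ⟩
    ∣ x₀ ∣ + 1ℚ           ∎
    where
    open +-*-Solver
    xn = seq x n ; x₀ = seq x n₀

share : ∀ {B δ} → 0ℚ < B → 0ℚ < δ → ∃ λ η → 0ℚ < η × B * η ≡ δ
share {B} {δ} 0<B 0<δ = δ * 1/ B , positive⁻¹ _ {{pos*pos⇒pos δ (1/ B) {{1/pos⇒pos B}}}} , eq
  where
  instance
    posB = positive 0<B
    posδ = positive 0<δ
    nzB = pos⇒nonZero B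
  eq : B * (δ * 1/ B) ≡ δ
  eq = trans (*-comm B _) (trans (*-assoc δ _ B) (trans (cong (δ *_) (*-inverseˡ B)) (*-identityʳ δ)))

∣∣*-mono : ∀ {p q B η} → 0ℚ < B → ∣ p ∣ ≤ B → ∣ q ∣ < η → ∣ p * q ∣ < B * η
∣∣*-mono {p} {q} {B} {η} 0<B p≤ q< = begin-strict
  ∣ p * q ∣      ≡⟨ ∣p*q∣≡∣p∣*∣q∣ p q ⟩
  ∣ p ∣ * ∣ q ∣  ≤⟨ *-monoʳ-≤-nonNeg ∣ q ∣ {{∣-∣-nonNeg q}} p≤ ⟩
  B * ∣ q ∣      <⟨ *-monoʳ-<-pos B {{positive 0<B}} q< ⟩
  B * η          ∎

product-close : ∀ a b c d {A B δ η θ} → 0ℚ < A → 0ℚ < B → A * η ≡ δ * ½ → B * θ ≡ δ * ½ →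
                ∣ a ∣ ≤ A → ∣ d ∣ ≤ B → ∣ b - d ∣ < η → ∣ a - c ∣ < θ → ∣ a * b - c * d ∣ < δ
product-close a b c d {A} {B} {δ} {η} {θ} 0<A 0<B Aη≡ Bθ≡ a≤ d≤ b-d< a-c< = begin-strict
  ∣ a * b - c * d ∣                    ≡⟨ cong ∣_∣ (solve 4 (λ a b c d → a :* b :- c :* d := a :* (b :- d) :+ d :* (a :- c)) refl a b c d) ⟩
  ∣ a * (b - d) + d * (a - c) ∣        ≤⟨ ∣p+q∣≤∣p∣+∣q∣ (a * (b - d)) (d * (a - c)) ⟩
  ∣ a * (b - d) ∣ + ∣ d * (a - c) ∣    <⟨ +-mono-< (∣∣*-mono {a} {b - d} 0<A a≤ b-d<) (∣∣*-mono {d} {a - c} 0<B d≤ a-c<) ⟩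
  A * η + B * θ                        ≡⟨ cong₂ _+_ Aη≡ Bθ≡ ⟩
  δ * ½ + δ * ½                        ≡⟨ halves δ ⟩
  δ                                    ∎
  where open +-*-Solver

_*ᴿ_ : ℝ → ℝ → ℝ
(x *ᴿ y) .seq n = seq x n * seq y n
(x *ᴿ y) .cauchy δ 0<δ =
  let A , 0<A , k , x≤  = bounded x
      B , 0<B , l , y≤  = bounded y
      η , 0<η , Aη≡     = share 0<A (half 0<δ)
      θ , 0<θ , Bθ≡     = share 0<B (half 0<δ)
      n₁ , cy           = cauchy y η 0<η
      n₂ , cx           = cauchy x θ 0<θ
  in (k ℕ.⊔ l) ℕ.⊔ (n₁ ℕ.⊔ n₂) , λ m n m≥ n≥ →
    let m≥₁ = ℕ.m⊔n≤o⇒m≤o (k ℕ.⊔ l) (n₁ ℕ.⊔ n₂) m≥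
        m≥₂ = ℕ.m⊔n≤o⇒n≤o (k ℕ.⊔ l) (n₁ ℕ.⊔ n₂) m≥
        n≥₁ = ℕ.m⊔n≤o⇒m≤o (k ℕ.⊔ l) (n₁ ℕ.⊔ n₂) n≥
        n≥₂ = ℕ.m⊔n≤o⇒n≤o (k ℕ.⊔ l) (n₁ ℕ.⊔ n₂) n≥
    in product-close (seq x m) (seq y m) (seq x n) (seq y n) 0<A 0<B Aη≡ Bθ≡
         (x≤ m (ℕ.m⊔n≤o⇒m≤o k l m≥₁)) (y≤ n (ℕ.m⊔n≤o⇒n≤o k l n≥₁))
         (cy m n (ℕ.m⊔n≤o⇒m≤o n₁ n₂ m≥₂) (ℕ.m⊔n≤o⇒m≤o n₁ n₂ n≥₂))
         (cx m n (ℕ.m⊔n≤o⇒n≤o n₁ n₂ m≥₂) (ℕ.m⊔n≤o⇒n≤o n₁ n₂ n≥₂))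

infixr 8 _^ℚ_

_^ℚ_ : ℚ → ℕ → ℚ
_^ℚ_ = pow +-*-rawSemiring

-- Mercator's series for -log (1 - t) at t = 1 - 1/N:
--   log N = ∑_{k ≥ 1} (1 - 1/N)ᵏ / k.
logPartialSum : (N : ℕ) .{{_ : NonZero N}} → ℕ → ℚ
logPartialSum N zero    = 0ℚ
logPartialSum N (suc n) = logPartialSum N n + (1ℚ - + 1 / N) ^ℚ suc n * (+ 1 / suc n)

1/-anti : ∀ {m n} → m ℕ.≤ n → + 1 / suc n ≤ + 1 / suc m
1/-anti {m} {n} m≤n = toℚᵘ-cancel-≤
  (ℚᵘ.≤-respˡ-≃ (ℚᵘ.≃-sym (toℚᵘ-fromℚᵘ (ℚᵘ.mkℚᵘ (+ 1) n)))
  (ℚᵘ.≤-respʳ-≃ (ℚᵘ.≃-sym (toℚᵘ-fromℚᵘ (ℚᵘ.mkℚᵘ (+ 1) m)))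
  (ℚᵘ.*≤* (+≤+ (ℕ.+-monoˡ-≤ 0 (ℕ.s≤s m≤n))))))

1/N-nonNeg : ∀ N .{{_ : NonZero N}} → NonNegative (+ 1 / N)
1/N-nonNeg N = normalize-nonNeg 1 N

N*1/N≡1 : ∀ N .{{_ : NonZero N}} → ℕ→ℚ N * (+ 1 / N) ≡ 1ℚ
N*1/N≡1 N@(suc m) = toℚᵘ-injective (ℚᵘ.≃-trans (toℚᵘ-homo-* (ℕ→ℚ N) (+ 1 / N))
  (ℚᵘ.≃-trans (ℚᵘ.*-cong (toℚᵘ-fromℚᵘ (ℚᵘ.mkℚᵘ (+ N) 0)) (toℚᵘ-fromℚᵘ (ℚᵘ.mkℚᵘ (+ 1) m)))
  (ℚᵘ.*≡* (cong +_ (trans (ℕ.*-identityʳ (N ℕ.* 1)) (trans (ℕ.*-identityʳ N)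
    (sym (trans (ℕ.*-identityˡ _) (ℕ.*-identityˡ N)))))))))

archimedean : ∀ N δ → 0ℚ < δ → ∃ λ n₀ → ∀ n → n₀ ℕ.≤ n → ℕ→ℚ N * (+ 1 / suc n) < δ
archimedean N δ@(mkℚ (+ zero) _ _) (*<* (+<+ ()))
archimedean N δ@(mkℚ +[1+ p ] q _) 0<δ = N ℕ.* suc q , λ n n≥ → toℚᵘ-cancel-<
  (ℚᵘ.<-respˡ-≃ (ℚᵘ.≃-sym (ℚᵘ.≃-trans (toℚᵘ-homo-* (ℕ→ℚ N) (+ 1 / suc n))
    (ℚᵘ.*-cong (toℚᵘ-fromℚᵘ (ℚᵘ.mkℚᵘ (+ N) 0)) (toℚᵘ-fromℚᵘ (ℚᵘ.mkℚᵘ (+ 1) n)))))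
  (ℚᵘ.*<* (subst₂ ℤ._<_
    (trans (cong +_ (cong (ℕ._* suc q) (sym (ℕ.*-identityʳ N))))
      (trans (ℤ.pos-* (N ℕ.* 1) (suc q)) (cong (ℤ._* + suc q) (ℤ.pos-* N 1))))
    (trans (ℤ.pos-* (suc p) (suc n)) (cong (+ suc p ℤ.*_) (cong +_ (sym (ℕ.*-identityˡ (suc n))))))
    (+<+ (ℕ.<-≤-trans (ℕ.s≤s n≥) (ℕ.m≤n*m (suc n) (suc p)))))))

module Log (N : ℕ) .{{_ : NonZero N}} where
  open +-*-Solver
  L = logPartialSum N
  x = 1ℚ - + 1 / N
  ν = ℕ→ℚ N

  1/N≤1 : ∀ N .{{_ : NonZero N}} → + 1 / N ≤ 1ℚ
  1/N≤1 (suc m) = 1/-anti {0} {m} ℕ.z≤n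

  x≥0 : 0ℚ ≤ x
  x≥0 = p≤q⇒0≤q-p (1/N≤1 N)

  x≤1 : x ≤ 1ℚ
  x≤1 = begin
    x                ≤⟨ p≤p+q x (nonNegative⁻¹ _ {{1/N-nonNeg N}}) ⟩
    x + + 1 / N      ≡⟨ solve 1 (λ u → (con 1ℚ :- u) :+ u := con 1ℚ) refl (+ 1 / N) ⟩
    1ℚ               ∎

  pow-nonNeg : ∀ n → NonNegative (x ^ℚ n)
  pow-nonNeg zero    = _
  pow-nonNeg (suc n) = nonNeg*nonNeg⇒nonNeg x {{nonNegative x≥0}} (x ^ℚ n) {{pow-nonNeg n}}

  pow≤1 : ∀ n → x ^ℚ n ≤ 1ℚ
  pow≤1 zero    = ≤-refl
  pow≤1 (suc n) = begin
    x * x ^ℚ n    ≤⟨ *-monoʳ-≤-nonNeg (x ^ℚ n) {{pow-nonNeg n}} x≤1 ⟩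
    1ℚ * x ^ℚ n   ≡⟨ *-identityˡ (x ^ℚ n) ⟩
    x ^ℚ n        ≤⟨ pow≤1 n ⟩
    1ℚ            ∎

  νx : 1ℚ + ν * x ≡ ν
  νx = trans (cong (_+ ν * x) (sym (N*1/N≡1 N)))
    (solve 2 (λ ν u → ν :* u :+ ν :* (con 1ℚ :- u) := ν) refl ν (+ 1 / N))

  term-nonNeg : ∀ n → 0ℚ ≤ x ^ℚ suc n * (+ 1 / suc n)
  term-nonNeg n = nonNegative⁻¹ _ {{nonNeg*nonNeg⇒nonNeg (x ^ℚ suc n) {{pow-nonNeg (suc n)}} (+ 1 / suc n) {{1/N-nonNeg (suc n)}}}}

  L-mono : ∀ {m n} → m ℕ.≤′ n → L m ≤ L n
  L-mono ℕ.≤′-refl             = ≤-refl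
  L-mono {n = suc n} (ℕ.≤′-step m≤n) = ≤-trans (L-mono m≤n) (p≤p+q (L n) (term-nonNeg n))

  tail : ∀ {m n} → m ℕ.≤′ n →
         L n + ν * (+ 1 / suc m) * x ^ℚ suc n ≤ L m + ν * (+ 1 / suc m) * x ^ℚ suc m
  tail ℕ.≤′-refl = ≤-refl
  tail {m} {suc n} (ℕ.≤′-step m≤n) = begin
    L n + X * (+ 1 / suc n) + ν * u * (x * X)
      ≤⟨ +-monoˡ-≤ _ (+-monoʳ-≤ (L n) (*-monoˡ-≤-nonNeg X {{pow-nonNeg (suc n)}} (1/-anti (ℕ.≤′⇒≤ m≤n)))) ⟩
    L n + X * u + ν * u * (x * X)
      ≡⟨ solve 5 (λ l X u ν x → l :+ X :* u :+ ν :* u :* (x :* X) := l :+ (con 1ℚ :+ ν :* x) :* u :* X) refl (L n) X u ν x ⟩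
    L n + (1ℚ + ν * x) * u * X   ≡⟨ cong (λ t → L n + t * u * X) νx ⟩
    L n + ν * u * X              ≤⟨ tail m≤n ⟩
    L m + ν * u * x ^ℚ suc m     ∎
    where
    u = + 1 / suc m
    X = x ^ℚ suc n

  νu-nonNeg : ∀ m → NonNegative (ν * (+ 1 / suc m))
  νu-nonNeg m = nonNeg*nonNeg⇒nonNeg ν {{normalize-nonNeg N 1}} (+ 1 / suc m) {{1/N-nonNeg (suc m)}}

  L-close : ∀ {m n} → m ℕ.≤ n → ∣ L n - L m ∣ ≤ ν * (+ 1 / suc m)
  L-close {m} {n} m≤n = begin
    ∣ L n - L m ∣                  ≡⟨ 0≤p⇒∣p∣≡p (p≤q⇒0≤q-p (L-mono (ℕ.≤⇒≤′ m≤n))) ⟩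
    L n - L m                      ≤⟨ +-monoˡ-≤ (- L m) (p≤p+q (L n) (nonNegative⁻¹ _ {{nonNeg*nonNeg⇒nonNeg w {{νu-nonNeg m}} (x ^ℚ suc n) {{pow-nonNeg (suc n)}}}})) ⟩
    L n + w * x ^ℚ suc n - L m     ≤⟨ +-monoˡ-≤ (- L m) (tail (ℕ.≤⇒≤′ m≤n)) ⟩
    L m + w * x ^ℚ suc m - L m     ≡⟨ solve 2 (λ l t → l :+ t :- l := t) refl (L m) (w * x ^ℚ suc m) ⟩
    w * x ^ℚ suc m                 ≤⟨ *-monoˡ-≤-nonNeg w {{νu-nonNeg m}} (pow≤1 (suc m)) ⟩
    w * 1ℚ                         ≡⟨ *-identityʳ w ⟩
    w                              ∎
    where w = ν * (+ 1 / suc m)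

log : (N : ℕ) .{{_ : NonZero N}} → ℝ
log N .seq = logPartialSum N
log N .cauchy δ 0<δ = n₀ , close
  where
  n₀ = proj₁ (archimedean N δ 0<δ)
  small = proj₂ (archimedean N δ 0<δ)
  open Log N using (L; L-close)
  close : ∀ m n → n₀ ℕ.≤ m → n₀ ℕ.≤ n → ∣ L m - L n ∣ < δ
  close m n m≥ n≥ = [ (λ m≤n → subst (_< δ) (∣p-q∣≡∣q-p∣ (L n) (L m)) (≤-<-trans (L-close m≤n) (small m m≥)))
                    , (λ n≤m → ≤-<-trans (L-close n≤m) (small n n≥)) ]′ (ℕ.≤-total m n)

infix 4 _^_≼_ _≤_·_^_

-- For N ≥ 1 and x ≥ 0 the real number Nˣ is the infimum of the rational powers
-- Nʳ over rationals r > x, so it is the infimum of the rationals q ≥ 0 satisfying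
-- Nᵃ ≤ qᵇ for some fraction a/b > x. Such an a/b is positive, so ∣ a ∣ = a.
_^_≼_ : ℕ → ℝ → ℚ → Set
N ^ x ≼ q = 0ℚ ≤ q × ∃ λ r → x <ᴿ fromℚ r × ℕ→ℚ (N ℕ.^ ℤ.∣ ↥ r ∣) ≤ q ^ℚ ↧ₙ r

-- h ≤ C · Nˣ, for C ≥ 0, N ≥ 1 and x ≥ 0.
_≤_·_^_ : ℕ → ℝ → ℕ → ℝ → Set
h ≤ C · N ^ x = ∀ q → N ^ x ≼ q → fromℕ h ≤ᴿ C *ᴿ fromℚ q

{-# OPTIONS --safe #-}
module Submission where

-- If a₀ = x², a₀ + a₁ = y², a₀ + b = z² and a₀ + a₁ + b = w², then
-- (y - x) (y + x) = a₁ = (w - z) (w + z).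
--
-- Once x and y are chosen in O(N) ways, every other edge b corresponds to a
-- divisor w - z of a₁, and τ(n)ᵏ = O(n) for every k gives H_d(N)ᵏ = O(Nᵏ⁺¹).
--
-- For d = 2 the equation A B = C D is solved by A = g s, B = t h, C = g t, D = s h,
-- where max(s, t) · max(g, h) = O(√N); summing over m = max(s, t) gives the upper
-- bound ∑ m (√N / m)² ≍ N log N. Conversely, coprime pairs s ≥ r with t = s + r, together
-- with g and h = 2 g + k, give distinct cubes, and passing to coprime pairs costs
-- only the factor ∑ 1/e² ≤ 2.

-- The counting uses only natural numbers. √N is replaced by a power of two P = 2^i with P² ≤ N < 4
-- P², so that i stands for log N up to a constant factor and harmonic sums split into dyadic
-- blocks. Real numbers enter at the end: i is compared with the partial sums of the series for log
-- N, and the exponent 1 + ε is reached by bounding k-th powers with 1/k < ε.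
--
-- Two obstacles shape the lower bound for d = 2. The roots are half sums and half differences of A,
-- B, C, D, which raises a parity condition; it disappears by taking A = 2 g s, B = 2 t h, C = 2 g
-- t, D = 2 s h. And the factors are not unique, since a common factor of s and t can be moved into
-- g and h; coprimality of s and r = t - s removes this freedom, so that a cube determines its
-- parameters.
--
-- The shape t = s + r, h = 2 g + k with r ≤ s comes from positivity: t ≤ 2 s and h ≥ 2 g give s h ≥
-- g t, hence x ≥ 0, and z - x = (t - s)(g + h) is positive because r is.

module Naturals where
  open import Data.Empty using (⊥; ⊥-elim)
  open import Data.Fin using (Fin; zero; suc; toℕ)
  open import Data.List using (List; []; _∷_; _++_; length; map; filter; concatMap; downFrom; upTo; cartesianProductWith)
  open import Data.List.Membership.Propositional using (_∈_; find; lose)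
  open import Data.List.Membership.Propositional.Properties
  open import Data.List.Properties using (length-++; length-map; length-downFrom; length-upTo)
  open import Data.List.Relation.Unary.All as All using (All; []; _∷_)
  open import Data.List.Relation.Unary.AllPairs using ([]; _∷_)
  open import Data.List.Relation.Unary.Any using (here; there)
  open import Data.List.Relation.Unary.Unique.Propositional using (Unique)
  import Data.List.Relation.Unary.Unique.Propositional.Properties as Unique
  open import Data.Nat
  open import Data.Nat.Coprimality using (Coprime; coprime?; coprime-divisor; GCD≡1⇒coprime)
  import Data.Nat.Coprimality as Coprimality
  open import Data.Nat.Divisibility
  open import Data.Nat.DivMod using (m≡m%n+[m/n]*n; m%n<n; m/n*n≤m; m*n/n≡m; /-monoˡ-≤)
  open import Data.Nat.GCD
  open import Data.Nat.Induction using (<-rec)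
  open import Data.Nat.ListAction using (sum; product)
  open import Data.Nat.ListAction.Properties using (∈⇒∣product)
  open import Data.Nat.Primality
  open import Data.Nat.Primality.Factorisation using (factorise; module PrimeFactorisation)
  open import Data.Nat.Properties
  open import Data.Nat.Tactic.RingSolver using (solve-∀)
  open import Data.Product using (∃; ∃₂; _×_; _,_; proj₁; proj₂)
  open import Data.Sum using (inj₁; inj₂)
  open import Data.Vec as Vec using (Vec; []; _∷_; lookup; zipWith)
  open import Function using (_∘_; it)
  open import Relation.Binary.PropositionalEquality hiding (J)
  open import Relation.Nullary using (yes; no)
  open import Relation.Unary using (_⊆_)
  open import Defs using (Squares; HilbertCube; cube⊆squares?; vectors; tuples; H)

  -- Comparing lengths of duplicate-free lists.

  private variable
    X Y Z : Set
    d : ℕ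

  -- Pigeonhole by deletion: the partner of the head is removed from `ys`, and injectivity
  -- guarantees that no later element loses its partner. A relation covers both uses, encoding by a
  -- function and decoding by one.
  relation⇒length≤ : {xs : List X} {ys : List Y} (R : X → Y → Set) → Unique xs →
    (∀ {x} → x ∈ xs → ∃ λ y → y ∈ ys × R x y) →
    (∀ {x x′ y} → x ∈ xs → x′ ∈ xs → R x y → R x′ y → x ≡ x′) →
    length xs ≤ length ys
  relation⇒length≤ {xs = []} R _ _ _ = z≤n
  relation⇒length≤ {xs = x ∷ xs} R (x∉xs ∷ unique) related injective
    with y , y∈ys , Rxy ← related (here refl)
    with as , bs , refl ← ∈-∃++ y∈ys = begin
    suc (length xs)                ≤⟨ s≤s (relation⇒length≤ R unique related′ (λ p q → injective (there p) (there q))) ⟩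
    suc (length (as ++ bs))        ≡⟨ cong suc (length-++ as) ⟩
    suc (length as + length bs)    ≡⟨ +-suc (length as) (length bs) ⟨
    length as + suc (length bs)    ≡⟨ length-++ as ⟨
    length (as ++ y ∷ bs)          ∎
    where
    open ≤-Reasoning
    related′ : ∀ {x′} → x′ ∈ xs → ∃ λ y′ → y′ ∈ as ++ bs × R x′ y′
    related′ x′∈xs with related (there x′∈xs)
    ... | y′ , y′∈ , Rx′y′ with ∈-++⁻ as y′∈
    ... | inj₁ y′∈as = y′ , ∈-++⁺ˡ y′∈as , Rx′y′
    ... | inj₂ (there y′∈bs) = y′ , ∈-++⁺ʳ as y′∈bs , Rx′y′
    ... | inj₂ (here refl) =
      ⊥-elim (All.lookup x∉xs x′∈xs (injective (here refl) (there x′∈xs) Rxy Rx′y′))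

  surjection⇒length≤ : {xs : List X} {ys : List Y} (f : Y → X) → Unique xs →
    (∀ {x} → x ∈ xs → ∃ λ y → y ∈ ys × x ≡ f y) → length xs ≤ length ys
  surjection⇒length≤ f unique onto =
    relation⇒length≤ (λ x y → x ≡ f y) unique onto (λ _ _ p q → trans p (sym q))

  injection⇒length≤ : {xs : List X} {ys : List Y} (f : X → Y) → Unique xs →
    (∀ {x} → x ∈ xs → f x ∈ ys) →
    (∀ {x x′} → x ∈ xs → x′ ∈ xs → f x ≡ f x′ → x ≡ x′) → length xs ≤ length ys
  injection⇒length≤ f unique into injective =
    relation⇒length≤ (λ x y → f x ≡ y) unique (λ {x} x∈ → f x , into x∈ , refl)
      (λ p q r s → injective p q (trans r (sym s)))

  -- Dependent products of lists and sums over ranges.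

  infixr 5 _⊗_

  opaque
    -- The second list may depend on the first entry, as in a pair (s, g) with g ≤ R / s. It is
    -- opaque, so that later proofs see only membership, uniqueness and length.
    _⊗_ : List X → (X → List Y) → List (X × Y)
    xs ⊗ f = concatMap (λ x → map (x ,_) (f x)) xs

    ∈-⊗⁺ : ∀ {xs : List X} {f : X → List Y} {x y} → x ∈ xs → y ∈ f x → (x , y) ∈ xs ⊗ f
    ∈-⊗⁺ {f = f} {x} x∈ y∈ = ∈-concatMap⁺ _ (lose x∈ (∈-map⁺ (x ,_) y∈))

    ∈-⊗⁻ : ∀ (xs : List X) {f : X → List Y} {x y} → (x , y) ∈ xs ⊗ f → x ∈ xs × y ∈ f x
    ∈-⊗⁻ xs {f} p with x , x∈ , q ← find (∈-concatMap⁻ _ {xs = xs} p)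
      with y , y∈ , refl ← ∈-map⁻ (x ,_) q = x∈ , y∈

    ⊗-unique : ∀ {xs : List X} {f : X → List Y} → Unique xs → (∀ x → Unique (f x)) → Unique (xs ⊗ f)
    ⊗-unique {xs = []} [] _ = []
    ⊗-unique {xs = x ∷ xs} {f} (x∉xs ∷ unique) uniques =
      Unique.++⁺ (Unique.map⁺ (cong proj₂) (uniques x)) (⊗-unique unique uniques) disjoint
      where
      disjoint : ∀ {p} → p ∈ map (x ,_) (f x) × p ∈ xs ⊗ f → ⊥
      disjoint (p , q) with _ , _ , refl ← ∈-map⁻ (x ,_) p = All.lookup x∉xs (proj₁ (∈-⊗⁻ xs q)) refl

    length-⊗ : ∀ (xs : List X) (f : X → List Y) → length (xs ⊗ f) ≡ sum (map (length ∘ f) xs)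
    length-⊗ []       f = refl
    length-⊗ (x ∷ xs) f = trans (length-++ (map (x ,_) (f x)))
      (cong₂ _+_ (length-map (x ,_) (f x)) (length-⊗ xs f))

  sum-mono : ∀ {f g : X → ℕ} (xs : List X) → (∀ {x} → x ∈ xs → f x ≤ g x) → sum (map f xs) ≤ sum (map g xs)
  sum-mono []       _   = z≤n
  sum-mono (x ∷ xs) f≤g = +-mono-≤ (f≤g (here refl)) (sum-mono xs (f≤g ∘ there))

  sum-*ˡ : ∀ c (f : X → ℕ) xs → sum (map (λ x → c * f x) xs) ≡ c * sum (map f xs)
  sum-*ˡ c f []       = sym (*-zeroʳ c)
  sum-*ˡ c f (x ∷ xs) = trans (cong (c * f x +_) (sum-*ˡ c f xs)) (sym (*-distribˡ-+ c (f x) _))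

  sum-const : ∀ c (xs : List X) → sum (map (λ _ → c) xs) ≡ length xs * c
  sum-const c []       = refl
  sum-const c (x ∷ xs) = cong (c +_) (sum-const c xs)

  length-⊗-const : ∀ (xs : List X) (f : X → List Y) {c} → (∀ x → length (f x) ≡ c) →
    length (xs ⊗ f) ≡ length xs * c
  length-⊗-const xs f {c} eq = trans (length-⊗ xs f) (trans (cong sum (helper xs)) (sum-const c xs))
    where
    helper : ∀ xs → map (length ∘ f) xs ≡ map (λ _ → c) xs
    helper []       = refl
    helper (x ∷ xs) = cong₂ _∷_ (eq x) (helper xs)

  -- Listed downwards, so that a sum up to `suc n` reduces to its last term plus the sum up to `n`.
  range : ℕ → List ℕ
  range n = map suc (downFrom n)

  ∈-range⁺ : ∀ {k n} → 1 ≤ k → k ≤ n → k ∈ range n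
  ∈-range⁺ {suc k} _ k<n = ∈-map⁺ suc (∈-downFrom⁺ k<n)

  ∈-range⁻ : ∀ {k n} → k ∈ range n → 1 ≤ k × k ≤ n
  ∈-range⁻ p with _ , j∈ , refl ← ∈-map⁻ suc p = s≤s z≤n , ∈-downFrom⁻ j∈

  range-unique : ∀ n → Unique (range n)
  range-unique n = Unique.map⁺ suc-injective (Unique.downFrom⁺ n)

  length-range : ∀ n → length (range n) ≡ n
  length-range n = trans (length-map suc (downFrom n)) (length-downFrom n)

  square : ℕ → List (ℕ × ℕ)
  square n = range n ⊗ λ _ → range n

  length-square : ∀ n → length (square n) ≡ n * n
  length-square n = trans (length-⊗-const (range n) _ (λ _ → length-range n)) (cong (_* n) (length-range n))

  square-unique : ∀ n → Unique (square n)
  square-unique n = ⊗-unique (range-unique n) (λ _ → range-unique n)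

  Σ[1⋯_] : ℕ → (ℕ → ℕ) → ℕ
  Σ[1⋯ n ] f = sum (map f (range n))

  -- Truncated division and dyadic sums.

  infixl 7 _div_

  -- Made total by the value 0 at divisor 0, so that it can be a summand without a side condition.
  _div_ : ℕ → ℕ → ℕ
  m div zero  = 0
  m div suc n = m / suc n

  m-div-n*n≤m : ∀ m n → m div n * n ≤ m
  m-div-n*n≤m m zero    = z≤n
  m-div-n*n≤m m (suc n) = m/n*n≤m m (suc n)

  k*n≤m⇒k≤m-div-n : ∀ {k m n} → 1 ≤ n → k * n ≤ m → k ≤ m div n
  k*n≤m⇒k≤m-div-n {k} {m} {suc n} _ le = subst (_≤ m / suc n) (m*n/n≡m k (suc n)) (/-monoˡ-≤ (suc n) le)

  div-anti : ∀ {a b} m → 1 ≤ a → a ≤ b → m div b ≤ m div a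
  div-anti {a} {b} m 1≤a a≤b = k*n≤m⇒k≤m-div-n 1≤a (≤-trans (*-monoʳ-≤ (m div b) a≤b) (m-div-n*n≤m m b))

  Σ-block-≤ : ∀ a b {c} (f : ℕ → ℕ) → (∀ k → a < k → f k ≤ c) → Σ[1⋯ b + a ] f ≤ b * c + Σ[1⋯ a ] f
  Σ-block-≤ a zero    f _ = ≤-refl
  Σ-block-≤ a (suc b) {c} f bound = begin
    f (suc (b + a)) + Σ[1⋯ b + a ] f    ≤⟨ +-mono-≤ (bound _ (s≤s (m≤n+m a b))) (Σ-block-≤ a b f bound) ⟩
    c + (b * c + Σ[1⋯ a ] f)            ≡⟨ +-assoc c (b * c) _ ⟨
    c + b * c + Σ[1⋯ a ] f              ∎
    where open ≤-Reasoning

  Σ-block-≥ : ∀ a b {c} (f : ℕ → ℕ) → (∀ k → a < k → k ≤ b + a → c ≤ f k) → b * c + Σ[1⋯ a ] f ≤ Σ[1⋯ b + a ] f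
  Σ-block-≥ a zero    f _ = ≤-refl
  Σ-block-≥ a (suc b) {c} f bound = begin
    c + b * c + Σ[1⋯ a ] f              ≡⟨ +-assoc c (b * c) _ ⟩
    c + (b * c + Σ[1⋯ a ] f)            ≤⟨ +-mono-≤ (bound _ (s≤s (m≤n+m a b)) ≤-refl) (Σ-block-≥ a b f (λ k p q → bound k p (m≤n⇒m≤1+n q))) ⟩
    f (suc (b + a)) + Σ[1⋯ b + a ] f    ∎
    where open ≤-Reasoning

  -- The block from 2^i to 2^(i+1) has 2^i terms, each at most M div 2^i, and so contributes at most
  -- M.
  Σ-div-≤ : ∀ M i → Σ[1⋯ 2 ^ i ] (M div_) ≤ suc i * M
  Σ-div-≤ M zero    = +-monoˡ-≤ 0 (subst (_≤ M) (*-identityʳ _) (m-div-n*n≤m M 1))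
  Σ-div-≤ M (suc i) = begin
    Σ[1⋯ 2 ^ suc i ] (M div_)                        ≡⟨ cong (λ n → Σ[1⋯ n ] (M div_)) (cong (2 ^ i +_) (+-identityʳ (2 ^ i))) ⟩
    Σ[1⋯ 2 ^ i + 2 ^ i ] (M div_)                    ≤⟨ Σ-block-≤ (2 ^ i) (2 ^ i) (M div_) (λ k le → div-anti M (m^n>0 2 i) (<⇒≤ le)) ⟩
    2 ^ i * (M div 2 ^ i) + Σ[1⋯ 2 ^ i ] (M div_)    ≤⟨ +-mono-≤ (≤-trans (≤-reflexive (*-comm (2 ^ i) _)) (m-div-n*n≤m M (2 ^ i))) (Σ-div-≤ M i) ⟩
    M + suc i * M                                    ∎
    where open ≤-Reasoning

  Σ-div² : ℕ → ℕ → ℕ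
  Σ-div² Q n = Σ[1⋯ n ] λ e → (Q div e) * (Q div e)

  -- The telescoping bound ∑ 1/e² ≤ 2 - 1/(n+1) for e ≤ n+1, with denominators cleared.
  Σ-div²-telescope : ∀ Q n → suc n * Σ-div² Q (suc n) + Q * Q ≤ 2 * (suc n * (Q * Q))
  Σ-div²-telescope Q zero = begin
    1 * (q * q + 0) + Q * Q   ≡⟨ cong (_+ Q * Q) (trans (*-identityˡ _) (+-identityʳ (q * q))) ⟩
    q * q + Q * Q             ≤⟨ +-monoˡ-≤ (Q * Q) (*-mono-≤ q≤Q q≤Q) ⟩
    Q * Q + Q * Q             ≡⟨ double (Q * Q) ⟩
    2 * (1 * (Q * Q))         ∎
    where
    open ≤-Reasoning
    q = Q div 1
    q≤Q : q ≤ Q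
    q≤Q = subst (_≤ Q) (*-identityʳ _) (m-div-n*n≤m Q 1)
    double : ∀ a → a + a ≡ 2 * (1 * a)
    double = solve-∀
  -- Scaling by `m` and adding `Q * Q` exposes `suc m` times the induction hypothesis. What remains
  -- is 1/(m+1)² ≤ 1/m - 1/(m+1) in the form m (m+1) q² ≤ Q².
  Σ-div²-telescope Q (suc n) = *-cancelˡ-≤ m (+-cancelʳ-≤ (Q * Q) _ _ (begin
    m * (suc m * (q * q + S) + Q * Q) + Q * Q             ≡⟨ identity₁ m q S (Q * Q) ⟩
    suc m * (m * S + Q * Q) + m * suc m * (q * q)         ≤⟨ +-mono-≤ (*-monoʳ-≤ (suc m) (Σ-div²-telescope Q n)) mq²≤ ⟩
    suc m * (2 * (m * (Q * Q))) + Q * Q                   ≡⟨ identity₂ m (Q * Q) ⟩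
    m * (2 * (suc m * (Q * Q))) + Q * Q                   ∎))
    where
    open ≤-Reasoning
    m = suc n
    S = Σ-div² Q m
    q = Q div suc m
    identity₁ : ∀ m q S P → m * (suc m * (q * q + S) + P) + P ≡ suc m * (m * S + P) + m * suc m * (q * q)
    identity₁ = solve-∀
    identity₂ : ∀ m P → suc m * (2 * (m * P)) + P ≡ m * (2 * (suc m * P)) + P
    identity₂ = solve-∀
    identity₃ : ∀ m q → suc m * suc m * (q * q) ≡ q * suc m * (q * suc m)
    identity₃ = solve-∀
    mq²≤ : m * suc m * (q * q) ≤ Q * Q
    mq²≤ = begin
      m * suc m * (q * q)          ≤⟨ *-monoˡ-≤ (q * q) (*-monoˡ-≤ (suc m) (n≤1+n m)) ⟩
      suc m * suc m * (q * q)      ≡⟨ identity₃ m q ⟩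
      q * suc m * (q * suc m)      ≤⟨ *-mono-≤ (m-div-n*n≤m Q (suc m)) (m-div-n*n≤m Q (suc m)) ⟩
      Q * Q                        ∎

  Σ-div²-≤ : ∀ Q → Σ-div² Q Q ≤ 2 * (Q * Q)
  Σ-div²-≤ zero    = z≤n
  Σ-div²-≤ (suc n) = *-cancelˡ-≤ (suc n) (begin
    suc n * S                      ≤⟨ m≤m+n (suc n * S) (Q * Q) ⟩
    suc n * S + Q * Q              ≤⟨ Σ-div²-telescope Q n ⟩
    2 * (suc n * (Q * Q))          ≡⟨ swap 2 (suc n) (Q * Q) ⟩
    suc n * (2 * (Q * Q))          ∎)
    where
    open ≤-Reasoning
    Q = suc n
    S = Σ-div² Q Q
    swap : ∀ a b c → a * (b * c) ≡ b * (a * c)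
    swap = solve-∀

  2^j≤2^i*[2^j-div-2^i] : ∀ {i j} → i ≤ j → 2 ^ j ≤ 2 ^ i * (2 ^ j div 2 ^ i)
  2^j≤2^i*[2^j-div-2^i] {i} {j} i≤j = begin
    2 ^ j                          ≡⟨ cong (2 ^_) (m+[n∸m]≡n i≤j) ⟨
    2 ^ (i + (j ∸ i))              ≡⟨ ^-distribˡ-+-* 2 i (j ∸ i) ⟩
    2 ^ i * 2 ^ (j ∸ i)            ≤⟨ *-monoʳ-≤ (2 ^ i) (k*n≤m⇒k≤m-div-n (m^n>0 2 i) (≤-reflexive
                                        (trans (sym (^-distribˡ-+-* 2 (j ∸ i) i)) (cong (2 ^_) (m∸n+n≡m i≤j))))) ⟩
    2 ^ i * (2 ^ j div 2 ^ i)      ∎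
    where open ≤-Reasoning

  -- In the block from P to 2 P every term is at least P (R div 2P)², so the P terms give R²/4 in
  -- all. With R and P powers of two, R div 2P is exact.
  Σ-weighted-≥ : ∀ j i → i ≤ j →
    i * (2 ^ j * 2 ^ j) ≤ 4 * Σ[1⋯ 2 ^ i ] (λ s → s * ((2 ^ j div s) * (2 ^ j div s)))
  Σ-weighted-≥ j zero    _   = z≤n
  Σ-weighted-≥ j (suc i) i<j = begin
    R * R + i * (R * R)                  ≤⟨ +-mono-≤ R²≤ (Σ-weighted-≥ j i (<⇒≤ i<j)) ⟩
    4 * (P * (P * (q * q))) + 4 * Σ[1⋯ P ] w
                                         ≡⟨ *-distribˡ-+ 4 (P * (P * (q * q))) _ ⟨
    4 * (P * (P * (q * q)) + Σ[1⋯ P ] w) ≤⟨ *-monoʳ-≤ 4 (Σ-block-≥ P P w block) ⟩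
    4 * Σ[1⋯ P + P ] w                   ≡⟨ cong (λ n → 4 * Σ[1⋯ P + n ] w) (+-identityʳ P) ⟨
    4 * Σ[1⋯ 2 ^ suc i ] w               ∎
    where
    open ≤-Reasoning
    R = 2 ^ j
    P = 2 ^ i
    q = R div (2 * P)
    w = λ s → s * ((R div s) * (R div s))
    identity : ∀ P q → 2 * P * q * (2 * P * q) ≡ 4 * (P * (P * (q * q)))
    identity = solve-∀
    R²≤ : R * R ≤ 4 * (P * (P * (q * q)))
    R²≤ = ≤-trans (*-mono-≤ (2^j≤2^i*[2^j-div-2^i] i<j) (2^j≤2^i*[2^j-div-2^i] i<j)) (≤-reflexive (identity P q))
    block : ∀ k → P < k → k ≤ P + P → P * (q * q) ≤ w k
    block k P<k k≤2P = *-mono-≤ (<⇒≤ P<k) (*-mono-≤ q≤ q≤)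
      where q≤ = div-anti R (≤-trans (s≤s z≤n) P<k) (≤-trans k≤2P (≤-reflexive (cong (P +_) (sym (+-identityʳ P)))))

  -- The divisor bound τ(n)^k ≤ C n.

  divisors : ℕ → List ℕ
  divisors n = filter (_∣? n) (range n)

  τ : ℕ → ℕ
  τ n = length (divisors n)

  ∣⇒∈-divisors : ∀ {e n} .{{_ : NonZero n}} → e ∣ n → e ∈ divisors n
  ∣⇒∈-divisors {zero}  {n} e∣n = ⊥-elim (≢-nonZero⁻¹ n (0∣⇒≡0 e∣n))
  ∣⇒∈-divisors {suc e} {n} e∣n = ∈-filter⁺ (_∣? n) (∈-range⁺ (s≤s z≤n) (∣⇒≤ e∣n)) e∣n

  ∈-divisors⇒∣ : ∀ {e n} → e ∈ divisors n → e ∣ n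
  ∈-divisors⇒∣ {n = n} e∈ = proj₂ (∈-filter⁻ (_∣? n) {xs = range n} e∈)

  ∤⇒coprime : ∀ {p e} → Prime p → p ∤ e → Coprime e p
  ∤⇒coprime pr p∤e (d∣e , d∣p) with prime⇒irreducible pr d∣p
  ... | inj₁ d≡1  = d≡1
  ... | inj₂ refl = ⊥-elim (p∤e d∣e)

  ∣p^a*m⇒split : ∀ {p} → Prime p → ∀ a {m e} → e ∣ p ^ a * m → ∃₂ λ i e′ → i ≤ a × e′ ∣ m × e ≡ p ^ i * e′
  ∣p^a*m⇒split pr zero    {m} {e} e∣ = 0 , e , z≤n , subst (e ∣_) (*-identityˡ m) e∣ , sym (*-identityˡ e)
  ∣p^a*m⇒split {p} pr (suc a) {m} {e} e∣ with p ∣? e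
  ... | yes (divides q refl)
    with i , e′ , i≤a , e′∣m , refl ← ∣p^a*m⇒split pr a {m} {q}
           (*-cancelˡ-∣ p {{prime⇒nonZero pr}} (subst₂ _∣_ (*-comm q p) (*-assoc p (p ^ a) m) e∣))
    = suc i , e′ , s≤s i≤a , e′∣m , trans (*-comm _ p) (sym (*-assoc p (p ^ i) e′))
  ... | no p∤e
    with i , e′ , i≤a , e′∣m , eq ← ∣p^a*m⇒split pr a {m} {e} (coprime-divisor (∤⇒coprime pr p∤e) (subst (e ∣_) (*-assoc p (p ^ a) m) e∣))
    = i , e′ , m≤n⇒m≤1+n i≤a , e′∣m , eq

  τ[p^a*m]≤[1+a]*τ[m] : ∀ {p} → Prime p → ∀ a m .{{_ : NonZero m}} → τ (p ^ a * m) ≤ suc a * τ m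
  τ[p^a*m]≤[1+a]*τ[m] {p} pr a m = begin
    τ (p ^ a * m)                    ≤⟨ surjection⇒length≤ (λ (i , e′) → p ^ i * e′) (Unique.filter⁺ (_∣? (p ^ a * m)) (range-unique (p ^ a * m))) onto ⟩
    length pairs                     ≡⟨ length-⊗-const (upTo (suc a)) (λ _ → divisors m) (λ _ → refl) ⟩
    length (upTo (suc a)) * τ m      ≡⟨ cong (_* τ m) (length-upTo (suc a)) ⟩
    suc a * τ m                      ∎
    where
    open ≤-Reasoning
    pairs = upTo (suc a) ⊗ λ _ → divisors m
    onto : ∀ {e} → e ∈ divisors (p ^ a * m) → ∃ λ y → y ∈ pairs × e ≡ p ^ proj₁ y * proj₂ y
    onto e∈ with i , e′ , i≤a , e′∣m , eq ← ∣p^a*m⇒split pr a (∈-divisors⇒∣ e∈) =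
      (i , e′) , ∈-⊗⁺ (∈-upTo⁺ (s≤s i≤a)) (∣⇒∈-divisors e′∣m) , eq

  ^-distribʳ-* : ∀ k m n → (m * n) ^ k ≡ m ^ k * n ^ k
  ^-distribʳ-* zero    m n = refl
  ^-distribʳ-* (suc k) m n = trans (cong (m * n *_) (^-distribʳ-* k m n)) (interchange m n (m ^ k) (n ^ k))
    where
    interchange : ∀ a b c d → a * b * (c * d) ≡ a * c * (b * d)
    interchange = solve-∀

  n^n≢0 : ∀ n → NonZero (n ^ n)
  n^n≢0 zero    = _
  n^n≢0 (suc n) = m^n≢0 (suc n) (suc n)

  1+n≤2^n : ∀ n → suc n ≤ 2 ^ n
  1+n≤2^n zero    = ≤-refl
  1+n≤2^n (suc n) = begin
    suc (suc n)          ≤⟨ s≤s (m≤n+m (suc n) n) ⟩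
    suc n + suc n        ≡⟨ cong (suc n +_) (+-identityʳ (suc n)) ⟨
    2 * suc n            ≤⟨ *-monoʳ-≤ 2 (1+n≤2^n n) ⟩
    2 ^ suc n            ∎
    where open ≤-Reasoning

  -- With q = a / k, 1 + a ≤ k (1 + q) ≤ k 2^q. The k-th power costs k^k and 2^(q k) ≤ 2^a.
  [1+a]^k≤k^k*2^a : ∀ k a → suc a ^ k ≤ k ^ k * 2 ^ a
  [1+a]^k≤k^k*2^a zero        a = ≤-trans (m^n>0 2 a) (≤-reflexive (sym (+-identityʳ (2 ^ a))))
  [1+a]^k≤k^k*2^a k@(suc _)   a = begin
    suc a ^ k                    ≤⟨ ^-monoˡ-≤ k 1+a≤ ⟩
    (2 ^ q * k) ^ k              ≡⟨ ^-distribʳ-* k (2 ^ q) k ⟩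
    (2 ^ q) ^ k * k ^ k          ≡⟨ cong (_* k ^ k) (^-*-assoc 2 q k) ⟩
    2 ^ (q * k) * k ^ k          ≤⟨ *-monoˡ-≤ (k ^ k) (^-monoʳ-≤ 2 (m/n*n≤m a k)) ⟩
    2 ^ a * k ^ k                ≡⟨ *-comm (2 ^ a) (k ^ k) ⟩
    k ^ k * 2 ^ a                ∎
    where
    open ≤-Reasoning
    q = a / k
    1+a≤ : suc a ≤ 2 ^ q * k
    1+a≤ = begin
      suc a                      ≡⟨ cong suc (m≡m%n+[m/n]*n a k) ⟩
      suc (a % k) + q * k        ≤⟨ +-monoˡ-≤ (q * k) (m%n<n a k) ⟩
      k + q * k                  ≤⟨ *-monoˡ-≤ k (1+n≤2^n q) ⟩
      2 ^ q * k                  ∎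

  split-power : ∀ p .{{_ : NonTrivial p}} n .{{_ : NonZero n}} → ∃₂ λ a m → n ≡ p ^ a * m × p ∤ m
  split-power p n = <-rec (λ n → .{{_ : NonZero n}} → ∃₂ λ a m → n ≡ p ^ a * m × p ∤ m) step n
    where
    step : ∀ n → (∀ {m} → m < n → .{{_ : NonZero m}} → ∃₂ λ a m′ → m ≡ p ^ a * m′ × p ∤ m′) →
           .{{_ : NonZero n}} → ∃₂ λ a m → n ≡ p ^ a * m × p ∤ m
    step n rec with p ∣? n
    ... | no p∤n = 0 , n , sym (*-identityˡ n) , p∤n
    ... | yes p∣n@(divides q refl) with a , m , refl , p∤m ← rec (quotient-< p∣n) {{quotient≢0 p∣n}} =
      suc a , m , trans (*-comm _ p) (sym (*-assoc p (p ^ a) m)) , p∤m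

  module _ (k : ℕ) where
    open ≤-Reasoning

    τ[p^a*m]^k≤ : ∀ {p c} → Prime p → ∀ a m .{{_ : NonZero m}} → τ m ^ k ≤ c * m →
                  τ (p ^ a * m) ^ k ≤ suc a ^ k * (c * m)
    τ[p^a*m]^k≤ {p} {c} pr a m bound = begin
      τ (p ^ a * m) ^ k            ≤⟨ ^-monoˡ-≤ k (τ[p^a*m]≤[1+a]*τ[m] pr a m) ⟩
      (suc a * τ m) ^ k            ≡⟨ ^-distribʳ-* k (suc a) (τ m) ⟩
      suc a ^ k * τ m ^ k          ≤⟨ *-monoʳ-≤ (suc a ^ k) bound ⟩
      suc a ^ k * (c * m)          ∎

    -- A prime p ≥ 2ᵏ multiplies τᵏ by at most 2ᵏ ≤ p.
    τ^k≤product : ∀ {ps} → All Prime ps → All (2 ^ k ≤_) ps → τ (product ps) ^ k ≤ product ps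
    τ^k≤product [] [] = ≤-reflexive (^-zeroˡ k)
    τ^k≤product {p ∷ ps} (pr ∷ prs) (p≥ ∷ ps≥) = begin
      τ (p * product ps) ^ k       ≡⟨ cong (λ q → τ (q * product ps) ^ k) (*-identityʳ p) ⟨
      τ (p ^ 1 * product ps) ^ k   ≤⟨ τ[p^a*m]^k≤ {c = 1} pr 1 (product ps) {{productOfPrimes≢0 prs}}
                                        (≤-trans (τ^k≤product prs ps≥) (≤-reflexive (sym (*-identityˡ (product ps))))) ⟩
      2 ^ k * (1 * product ps)     ≡⟨ cong (2 ^ k *_) (*-identityˡ (product ps)) ⟩
      2 ^ k * product ps           ≤⟨ *-monoˡ-≤ (product ps) p≥ ⟩
      p * product ps               ∎

    -- Roughness puts every prime factor at or above 2^k, the range in which no constant is lost.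
    rough⇒τ^k≤ : ∀ {ℓ} → 2 ^ k ≤ ℓ → ∀ n .{{_ : NonZero n}} → ℓ Rough n → τ n ^ k ≤ n
    rough⇒τ^k≤ {ℓ} 2^k≤ℓ n rough = subst (λ n → τ n ^ k ≤ n) (sym isFactorisation)
      (τ^k≤product factorsPrime (All.map large (All.zip (factorsPrime , All.tabulate divides-n))))
      where
      open PrimeFactorisation (factorise n)
      divides-n : ∀ {p} → p ∈ factors → p ∣ n
      divides-n p∈ = subst (_ ∣_) (sym isFactorisation) (∈⇒∣product p∈)
      large : ∀ {p} → Prime p × p ∣ n → 2 ^ k ≤ p
      large (pr , p∣n) = ≤-trans 2^k≤ℓ (rough⇒≤ {{prime⇒nonTrivial pr}} (rough∧∣⇒rough rough p∣n))

    -- The candidates ℓ = 2, 3, ... are sieved out until 2^k is reached, `j` counting those left. An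
    -- ℓ dividing an ℓ-rough number is prime, and removing ℓ^a costs (1 + a)^k ≤ k^k 2^a ≤ k^k ℓ^a,
    -- thus one factor k^k per candidate.
    τ^k≤-rough : ∀ j ℓ .{{_ : NonTrivial ℓ}} → 2 ^ k ≤ j + ℓ → ∀ n .{{_ : NonZero n}} → ℓ Rough n →
                 τ n ^ k ≤ (k ^ k) ^ j * n
    τ^k≤-rough zero    ℓ large n rough = ≤-trans (rough⇒τ^k≤ large n rough) (≤-reflexive (sym (*-identityˡ n)))
    τ^k≤-rough (suc j) ℓ large n rough with split-power ℓ n
    ... | zero  , m , n≡m , ℓ∤m = begin
      τ n ^ k                      ≤⟨ τ^k≤-rough j (suc ℓ) {{n>1⇒nonTrivial (m<n⇒m<1+n (nonTrivial⇒n>1 ℓ))}} (subst (2 ^ k ≤_) (sym (+-suc j ℓ)) large) n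
                                        (∤⇒rough-suc (λ ℓ∣n → ℓ∤m (subst (ℓ ∣_) (trans n≡m (*-identityˡ m)) ℓ∣n)) rough) ⟩
      (k ^ k) ^ j * n              ≤⟨ *-monoˡ-≤ n (m≤n*m ((k ^ k) ^ j) (k ^ k) {{n^n≢0 k}}) ⟩
      (k ^ k) ^ suc j * n          ∎
    ... | a@(suc a-1) , m , refl , ℓ∤m = begin
      τ (ℓ ^ a * m) ^ k                            ≤⟨ τ[p^a*m]^k≤ {c = (k ^ k) ^ j} ℓ-prime a m {{m≢0}} rest ⟩
      suc a ^ k * ((k ^ k) ^ j * m)                ≤⟨ *-monoˡ-≤ _ ([1+a]^k≤k^k*2^a k a) ⟩
      k ^ k * 2 ^ a * ((k ^ k) ^ j * m)            ≤⟨ *-monoˡ-≤ _ (*-monoʳ-≤ (k ^ k) (^-monoˡ-≤ a (nonTrivial⇒n>1 ℓ))) ⟩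
      k ^ k * ℓ ^ a * ((k ^ k) ^ j * m)            ≡⟨ interchange (k ^ k) (ℓ ^ a) ((k ^ k) ^ j) m ⟩
      (k ^ k) ^ suc j * (ℓ ^ a * m)                ∎
      where
      interchange : ∀ a b c d → a * b * (c * d) ≡ a * c * (b * d)
      interchange = solve-∀
      m≢0 : NonZero m
      m≢0 = m*n≢0⇒n≢0 (ℓ ^ a)
      ℓ-prime : Prime ℓ
      ℓ-prime = rough∧∣⇒prime rough (∣-trans (m∣m*n (ℓ ^ a-1)) (m∣m*n m))
      rest = τ^k≤-rough j (suc ℓ) {{n>1⇒nonTrivial (m<n⇒m<1+n (nonTrivial⇒n>1 ℓ))}} (subst (2 ^ k ≤_) (sym (+-suc j ℓ)) large) m {{m≢0}}
        (∤⇒rough-suc ℓ∤m (rough∧∣⇒rough rough (n∣m*n (ℓ ^ a))))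

    -- One factor k^k for each of 2^k sieving steps.
    τ-constant : ℕ
    τ-constant = (k ^ k) ^ (2 ^ k)

    τ-constant≢0 : NonZero τ-constant
    τ-constant≢0 = m^n≢0 (k ^ k) (2 ^ k) {{n^n≢0 k}}

    τ^k≤C*n : ∀ n .{{_ : NonZero n}} → τ n ^ k ≤ τ-constant * n
    τ^k≤C*n n = τ^k≤-rough (2 ^ k) 2 (m≤m+n (2 ^ k) 2) n 2-rough

  -- As τ is not monotone, its value at a maximiser serves as the uniform bound. A single `n` allows
  -- the d-th power to be taken before the exponent k is chosen.
  τ-max : ∀ X .{{_ : NonZero X}} → ∃ λ n → NonZero n × n ≤ X × (∀ m → m ≤ X → τ m ≤ τ n)
  τ-max (suc zero)      = 1 , _ , ≤-refl , λ { zero _ → z≤n ; (suc zero) _ → ≤-refl ; (suc (suc _)) (s≤s ()) }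
  τ-max (suc X@(suc _)) with n , n≢0 , n≤X , max ← τ-max X with ≤-total (τ n) (τ (suc X))
  ... | inj₁ le = suc X , _ , ≤-refl , λ m m≤1+X → bound m (m≤n⇒m<n∨m≡n m≤1+X)
    where
    bound : ∀ m → _ → τ m ≤ τ (suc X)
    bound m (inj₁ (s≤s m≤X)) = ≤-trans (max m m≤X) le
    bound m (inj₂ refl)      = ≤-refl
  ... | inj₂ ge = n , n≢0 , m≤n⇒m≤1+n n≤X , λ m m≤1+X → bound m (m≤n⇒m<n∨m≡n m≤1+X)
    where
    bound : ∀ m → _ → τ m ≤ τ n
    bound m (inj₁ (s≤s m≤X)) = max m m≤X
    bound m (inj₂ refl)      = ge

  -- Square roots, exact and up to a factor of two.

  a²≤b²⇒a≤b : ∀ {a b} → a * a ≤ b * b → a ≤ b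
  a²≤b²⇒a≤b {a} {b} a²≤b² = ≮⇒≥ λ b<a → <⇒≱ (*-mono-< b<a b<a) a²≤b²

  a²<b²⇒a<b : ∀ {a b} → a * a < b * b → a < b
  a²<b²⇒a<b {a} {b} a²<b² = ≰⇒> λ b≤a → <⇒≱ a²<b² (*-mono-≤ b≤a b≤a)

  a²≡b²⇒a≡b : ∀ {a b} → a * a ≡ b * b → a ≡ b
  a²≡b²⇒a≡b eq = ≤-antisym (a²≤b²⇒a≤b (≤-reflexive eq)) (a²≤b²⇒a≤b (≤-reflexive (sym eq)))

  -- The power of two within a factor of two of √N; its exponent later plays the logarithm. In the
  -- induction `i` moves up exactly when `suc N` reaches 4 · 4^i = (2^(i+1))².
  dyadic-root : ∀ N .{{_ : NonZero N}} → ∃ λ i → 2 ^ i * 2 ^ i ≤ N × N < 4 * (2 ^ i * 2 ^ i)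
  dyadic-root (suc zero)      = 0 , ≤-refl , s≤s (s≤s z≤n)
  dyadic-root (suc N@(suc _)) with i , lower , upper ← dyadic-root N with suc N <? 4 * (2 ^ i * 2 ^ i)
  ... | yes small = i , m≤n⇒m≤1+n lower , small
  ... | no  large = suc i , ≤-trans (≤-reflexive (quadruple (2 ^ i))) (≮⇒≥ large) , (begin-strict
    suc N                                ≤⟨ upper ⟩
    4 * (2 ^ i * 2 ^ i)                  ≡⟨ quadruple (2 ^ i) ⟨
    2 ^ suc i * 2 ^ suc i                <⟨ m<m*n (2 ^ suc i * 2 ^ suc i) 4 {{>-nonZero (*-mono-≤ (m^n>0 2 (suc i)) (m^n>0 2 (suc i)))}} (s≤s (s≤s z≤n)) ⟩
    2 ^ suc i * 2 ^ suc i * 4            ≡⟨ *-comm (2 ^ suc i * 2 ^ suc i) 4 ⟩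
    4 * (2 ^ suc i * 2 ^ suc i)          ∎)
    where
    open ≤-Reasoning
    quadruple : ∀ p → 2 * p * (2 * p) ≡ 4 * (p * p)
    quadruple = solve-∀

  -- Vertices of Hilbert cubes and the list of all cubes.

  subset-sum : Vec (Fin 2) d → Vec ℕ d → ℕ
  subset-sum ε a = Vec.sum (zipWith (λ εᵢ aᵢ → toℕ εᵢ * aᵢ) ε a)

  empty-sum : ∀ (a : Vec ℕ d) → ∃ λ ε → subset-sum ε a ≡ 0
  empty-sum []      = [] , refl
  empty-sum (x ∷ a) with ε , eq ← empty-sum a = zero ∷ ε , eq

  singleton-sum : ∀ (a : Vec ℕ d) i → ∃ λ ε → subset-sum ε a ≡ lookup a i
  singleton-sum (x ∷ a) zero with ε , eq ← empty-sum a =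
    suc zero ∷ ε , trans (cong₂ _+_ (*-identityˡ x) eq) (+-identityʳ x)
  singleton-sum (x ∷ a) (suc i) with ε , eq ← singleton-sum a i = zero ∷ ε , eq

  square-root : ∀ {m} → Squares m → ∃ λ n → m ≡ n * n
  square-root (n , eq) = n , trans eq (cong (n *_) (*-identityʳ n))

  module _ {a₀ a₁} {as : Vec ℕ d} (cube : HilbertCube a₀ (a₁ ∷ as) ⊆ Squares) where

    origin-root : ∃ λ x → a₀ ≡ x * x
    origin-root with ε , eq ← empty-sum as =
      square-root (cube (zero ∷ ε , trans (sym (+-identityʳ a₀)) (cong (a₀ +_) (sym eq))))

    edge-root : ∃ λ y → a₀ + a₁ ≡ y * y
    edge-root with ε , eq ← empty-sum as =
      square-root (cube (suc zero ∷ ε , cong (a₀ +_) (sym (trans (cong₂ _+_ (*-identityˡ a₁) eq) (+-identityʳ a₁)))))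

    face-roots : ∀ i → ∃₂ λ z w → a₀ + lookup as i ≡ z * z × a₀ + (a₁ + lookup as i) ≡ w * w
    face-roots i with ε , eq ← singleton-sum as i
      with z , z² ← square-root (cube (zero ∷ ε , cong (a₀ +_) (sym eq)))
         | w , w² ← square-root (cube (suc zero ∷ ε , cong (a₀ +_) (sym (cong₂ _+_ (*-identityˡ a₁) eq))))
      = z , w , z² , w²

  length-cartesianProductWith : ∀ (f : X → Y → Z) xs ys →
    length (cartesianProductWith f xs ys) ≡ length xs * length ys
  length-cartesianProductWith f []       ys = refl
  length-cartesianProductWith f (x ∷ xs) ys =
    trans (length-++ (map (f x) ys)) (cong₂ _+_ (length-map (f x) ys) (length-cartesianProductWith f xs ys))

  length-vectors : ∀ d (xs : List X) → length (vectors d xs) ≡ length xs ^ d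
  length-vectors zero    xs = refl
  length-vectors (suc d) xs =
    trans (length-cartesianProductWith _∷_ xs (vectors d xs)) (cong (length xs *_) (length-vectors d xs))

  ∈-vectors⁺ : ∀ {xs : List X} (v : Vec X d) → (∀ i → lookup v i ∈ xs) → v ∈ vectors d xs
  ∈-vectors⁺ []      _ = here refl
  ∈-vectors⁺ (x ∷ v) p = ∈-cartesianProductWith⁺ _∷_ (p zero) (∈-vectors⁺ v (p ∘ suc))

  ∈-vectors⁻ : ∀ {xs : List X} (v : Vec X d) → v ∈ vectors d xs → ∀ i → lookup v i ∈ xs
  ∈-vectors⁻ {d = suc d} {xs} v v∈ i with ∈-cartesianProductWith⁻ _∷_ xs (vectors d xs) v∈
  ∈-vectors⁻ v v∈ zero    | x , w , x∈ , w∈ , refl = x∈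
  ∈-vectors⁻ v v∈ (suc i) | x , w , x∈ , w∈ , refl = ∈-vectors⁻ w w∈ i

  vectors-unique : ∀ d {xs : List X} → Unique xs → Unique (vectors d xs)
  vectors-unique zero    _      = [] ∷ []
  vectors-unique (suc d) unique = Unique.cartesianProductWith⁺ _∷_ (λ { refl → refl , refl }) unique (vectors-unique d unique)

  opaque
    -- The list counted by `H`, kept opaque so that the decision procedure behind it never unfolds.
    cubes : ∀ d → ℕ → List (ℕ × Vec ℕ d)
    cubes d N = filter cube⊆squares? (tuples d N)

    length-cubes : ∀ d N → length (cubes d N) ≡ H d N
    length-cubes d N = refl

    cubes-unique : ∀ d N → Unique (cubes d N)
    cubes-unique d N = Unique.filter⁺ cube⊆squares?
      (Unique.cartesianProduct⁺ (Unique.upTo⁺ (suc N)) (vectors-unique d (Unique.map⁺ suc-injective (Unique.upTo⁺ N))))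

    ∈-cubes⁺ : ∀ {N a₀} {a : Vec ℕ d} → a₀ ≤ N → (∀ i → 1 ≤ lookup a i × lookup a i ≤ N) →
      HilbertCube a₀ a ⊆ Squares → (a₀ , a) ∈ cubes d N
    ∈-cubes⁺ {N = N} {a = a} a₀≤N bounds cube = ∈-filter⁺ cube⊆squares?
      (∈-cartesianProduct⁺ (∈-upTo⁺ (s≤s a₀≤N)) (∈-vectors⁺ a (λ i → entry (bounds i)))) cube
      where
      entry : ∀ {k} → 1 ≤ k × k ≤ N → k ∈ map suc (upTo N)
      entry (s≤s _ , k≤N) = ∈-map⁺ suc (∈-upTo⁺ k≤N)

    ∈-cubes⁻ : ∀ N {a₀} {a : Vec ℕ d} → (a₀ , a) ∈ cubes d N →
      a₀ ≤ N × (∀ i → 1 ≤ lookup a i × lookup a i ≤ N) × HilbertCube a₀ a ⊆ Squares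
    ∈-cubes⁻ {d} N {a₀} {a} t∈
      with t∈tuples , cube ← ∈-filter⁻ cube⊆squares? {xs = tuples d N} t∈
      with a₀∈ , a∈ ← ∈-cartesianProduct⁻ (upTo (suc N)) (vectors d (map suc (upTo N))) t∈tuples
      = ≤-pred (∈-upTo⁻ a₀∈) , (λ i → entry (∈-vectors⁻ a a∈ i)) , cube
      where
      entry : ∀ {k} → k ∈ map suc (upTo N) → 1 ≤ k × k ≤ N
      entry k∈ with _ , j∈ , refl ← ∈-map⁻ suc k∈ = s≤s z≤n , ∈-upTo⁻ j∈

  -- The bound N τ(n)^d in dimension d + 1.

  k*n-div-n : ∀ k n .{{_ : NonZero n}} → (k * n) div n ≡ k
  k*n-div-n k n@(suc _) = m*n/n≡m k n

  length-⊗-≤ : ∀ (xs : List X) {f : X → List Y} {c} → (∀ {x} → x ∈ xs → length (f x) ≤ c) →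
    length (xs ⊗ f) ≤ length xs * c
  length-⊗-≤ xs {f} {c} bound = begin
    length (xs ⊗ f)               ≡⟨ length-⊗ xs f ⟩
    sum (map (length ∘ f) xs)     ≤⟨ sum-mono xs bound ⟩
    sum (map (λ _ → c) xs)        ≡⟨ sum-const c xs ⟩
    length xs * c                 ∎
    where open ≤-Reasoning

  -- The edge b with x² + b = z² and z² + n = w² is recovered from the divisor e = w - z of n.

  edge-candidate : ℕ → ℕ → ℕ → ℕ
  edge-candidate x n e = let z = (n div e ∸ e) div 2 in z * z ∸ x * x

  edge-candidates : ℕ → ℕ → List ℕ
  edge-candidates x n = map (edge-candidate x n) (divisors n)

  w²∸z² : ∀ {n z w} → z * z + n ≡ w * w → ∃ λ e → w ≡ z + e × n ≡ (z + (z + e)) * e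
  w²∸z² {n} {z} {w} eq with e , refl ← m≤n⇒∃[o]m+o≡n (a²≤b²⇒a≤b {z} {w} (subst (z * z ≤_) eq (m≤m+n (z * z) n))) =
    e , refl , +-cancelˡ-≡ (z * z) _ _ (trans eq (identity z e))
    where
    identity : ∀ z e → (z + e) * (z + e) ≡ z * z + (z + (z + e)) * e
    identity = solve-∀

  a+b+c≡a+[c+b] : ∀ a b c → a + b + c ≡ a + (c + b)
  a+b+c≡a+[c+b] = solve-∀

  -- The cofactor of e = w - z is w + z = 2 z + e, so this is how the smaller root is decoded, here
  -- and in `square-cube`.
  [z+z+e∸e]div2≡z : ∀ z e → (z + (z + e) ∸ e) div 2 ≡ z
  [z+z+e∸e]div2≡z z e = begin
    (z + (z + e) ∸ e) div 2      ≡⟨ cong (λ m → (m ∸ e) div 2) (identity z e) ⟩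
    (z * 2 + e ∸ e) div 2        ≡⟨ cong (_div 2) (m+n∸n≡m (z * 2) e) ⟩
    (z * 2) div 2                ≡⟨ k*n-div-n z 2 ⟩
    z                            ∎
    where
    open ≡-Reasoning
    identity : ∀ z e → z + (z + e) ≡ z * 2 + e
    identity = solve-∀

  ∈-edge-candidates : ∀ {x n b z w} .{{_ : NonZero n}} → x * x + b ≡ z * z → z * z + n ≡ w * w → b ∈ edge-candidates x n
  ∈-edge-candidates {x} {n} {b} {z} {w} z² w² with e , _ , refl ← w²∸z² {n} {z} {w} w² =
    subst (_∈ edge-candidates x n) candidate≡b (∈-map⁺ (edge-candidate x n) (∣⇒∈-divisors (n∣m*n (z + (z + e)))))
    where
    open ≡-Reasoning
    instance e≢0 = m*n≢0⇒n≢0 (z + (z + e)) {e}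
    z≡ : (n div e ∸ e) div 2 ≡ z
    z≡ = trans (cong (λ m → (m ∸ e) div 2) (k*n-div-n (z + (z + e)) e)) ([z+z+e∸e]div2≡z z e)
    candidate≡b : edge-candidate x n e ≡ b
    candidate≡b = begin
      edge-candidate x n e       ≡⟨ cong (λ z → z * z ∸ x * x) z≡ ⟩
      z * z ∸ x * x              ≡⟨ cong (_∸ x * x) z² ⟨
      x * x + b ∸ x * x          ≡⟨ m+n∸m≡n (x * x) b ⟩
      b                          ∎

  module _ (d N : ℕ) .{{_ : NonZero N}} where
    open ≤-Reasoning

    -- There are S² ≤ 16 N pairs of roots (x, y). Given one, each of the d other edges has τ(y² -
    -- x²) candidates, and y² - x² ≤ 16 N makes τ(n) a common bound.
    H≤16N*τ^d : ∃ λ n → NonZero n × n ≤ 16 * N × H (suc d) N ≤ 16 * N * τ n ^ d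
    H≤16N*τ^d with i , P²≤N , N<4P² ← dyadic-root N
      with n , n≢0 , n≤16N , τ≤τ[n] ← τ-max (16 * N) {{m*n≢0 16 N}} = n , n≢0 , n≤16N , (begin
      H (suc d) N                         ≡⟨ length-cubes (suc d) N ⟨
      length (cubes (suc d) N)            ≤⟨ surjection⇒length≤ cube (cubes-unique (suc d) N) onto ⟩
      length (roots ⊗ edges)              ≤⟨ length-⊗-≤ roots edges≤ ⟩
      length roots * τ n ^ d              ≡⟨ cong (_* τ n ^ d) (trans (length-⊗-const (upTo S) (λ _ → upTo S) (λ _ → length-upTo S)) (cong (_* S) (length-upTo S))) ⟩
      S * S * τ n ^ d                     ≤⟨ *-monoˡ-≤ (τ n ^ d) S²≤16N ⟩
      16 * N * τ n ^ d                    ∎)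
      where
      P = 2 ^ i
      -- Both x² and y² are at most 2 N < 8 P², so roots below 4 P suffice.
      S = 4 * P
      roots = upTo S ⊗ λ _ → upTo S
      edges : ℕ × ℕ → List (Vec ℕ d)
      edges (x , y) = vectors d (edge-candidates x (y * y ∸ x * x))
      cube : (ℕ × ℕ) × Vec ℕ d → ℕ × Vec ℕ (suc d)
      cube ((x , y) , v) = x * x , (y * y ∸ x * x) ∷ v
      S²≡ : ∀ p → 4 * p * (4 * p) ≡ 16 * (p * p)
      S²≡ = solve-∀
      S²≤16N : S * S ≤ 16 * N
      S²≤16N = ≤-trans (≤-reflexive (S²≡ P)) (*-monoʳ-≤ 16 P²≤N)
      2N<S² : N + N < S * S
      2N<S² = begin-strict
        N + N                              <⟨ +-mono-< N<4P² N<4P² ⟩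
        4 * (P * P) + 4 * (P * P)          ≤⟨ m≤m+n _ (8 * (P * P)) ⟩
        4 * (P * P) + 4 * (P * P) + 8 * (P * P)  ≡⟨ identity P ⟩
        S * S                              ∎
        where
        identity : ∀ p → 4 * (p * p) + 4 * (p * p) + 8 * (p * p) ≡ 4 * p * (4 * p)
        identity = solve-∀
      edges≤ : ∀ {xy} → xy ∈ roots → length (edges xy) ≤ τ n ^ d
      edges≤ {x , y} xy∈ = begin
        length (edges (x , y))             ≡⟨ length-vectors d (edge-candidates x m) ⟩
        length (edge-candidates x m) ^ d   ≡⟨ cong (_^ d) (length-map (edge-candidate x m) (divisors m)) ⟩
        τ m ^ d                            ≤⟨ ^-monoˡ-≤ d (τ≤τ[n] m m≤16N) ⟩
        τ n ^ d                            ∎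
        where
        m = y * y ∸ x * x
        y<S = ∈-upTo⁻ (proj₂ (∈-⊗⁻ (upTo S) xy∈))
        m≤16N : m ≤ 16 * N
        m≤16N = ≤-trans (m∸n≤m (y * y) (x * x)) (≤-trans (*-mono-≤ (<⇒≤ y<S) (<⇒≤ y<S)) S²≤16N)
      onto : ∀ {t} → t ∈ cubes (suc d) N → ∃ λ p → p ∈ roots ⊗ edges × t ≡ cube p
      onto {a₀ , a₁ ∷ as} t∈
        with a₀≤N , bounds , cube⊆ ← ∈-cubes⁻ N t∈
        with x , refl ← origin-root cube⊆ | y , y² ← edge-root cube⊆
        = ((x , y) , as) , ∈-⊗⁺ (∈-⊗⁺ (∈-upTo⁺ x<S) (∈-upTo⁺ y<S)) (∈-vectors⁺ as edge∈)
        , cong (λ m → x * x , m ∷ as) a₁≡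
        where
        x²+a₁<S² : x * x + a₁ < S * S
        x²+a₁<S² = ≤-<-trans (+-mono-≤ a₀≤N (proj₂ (bounds zero))) 2N<S²
        x<S : x < S
        x<S = a²<b²⇒a<b (≤-<-trans (m≤m+n (x * x) a₁) x²+a₁<S²)
        y<S : y < S
        y<S = a²<b²⇒a<b (subst (_< S * S) y² x²+a₁<S²)
        a₁≡ : a₁ ≡ y * y ∸ x * x
        a₁≡ = trans (sym (m+n∸m≡n (x * x) a₁)) (cong (_∸ x * x) y²)
        edge∈ : ∀ i → lookup as i ∈ edge-candidates x (y * y ∸ x * x)
        edge∈ i with z , w , z² , w² ← face-roots cube⊆ i =
          subst (λ m → lookup as i ∈ edge-candidates x m) a₁≡
            (∈-edge-candidates {x} {a₁} {lookup as i} {z} {w} {{>-nonZero (proj₁ (bounds zero))}} z² w²′)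
          where
          b = lookup as i
          w²′ : z * z + a₁ ≡ w * w
          w²′ = trans (cong (_+ a₁) (sym z²)) (trans (a+b+c≡a+[c+b] (x * x) b a₁) w²)

  -- Upper bound in dimension 2.

  reduce : ∀ a b .{{_ : NonZero a}} → ∃ λ g → ∃₂ λ s t → NonZero g × a ≡ s * g × b ≡ t * g × Coprime s t
  reduce a b with divides s a≡ ← gcd[m,n]∣m a b | divides t b≡ ← gcd[m,n]∣n a b =
    g , s , t , g≢0 , a≡ , b≡ , GCD≡1⇒coprime (GCD-* {s} {t} {1} {g} {{g≢0}}
      (subst₂ (λ u v → GCD u v (1 * g)) a≡ b≡ (subst (GCD a b) (sym (*-identityˡ g)) (gcd-GCD a b))))
    where
    g = gcd a b
    g≢0 : NonZero g
    g≢0 = ≢-nonZero (gcd[m,n]≢0 a b (inj₁ (≢-nonZero⁻¹ a)))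

  -- Here s / t is A / C in lowest terms and g their gcd. Cancelling g leaves s B = t D, so t
  -- divides B, and h is the quotient.
  four-numbers : ∀ {A B C D} .{{_ : NonZero A}} .{{_ : NonZero C}} → A * B ≡ C * D →
    ∃₂ λ s t → ∃₂ λ g h → A ≡ s * g × C ≡ t * g × B ≡ h * t × D ≡ s * h
  four-numbers {A} {B} {C} {D} eq with g , s , t , g≢0 , refl , refl , s⊥t ← reduce A C = conclude t∣B
    where
    cancelled : s * B ≡ t * D
    cancelled = *-cancelʳ-≡ (s * B) (t * D) g {{g≢0}} (trans (swap s B g) (trans eq (sym (swap t D g))))
      where
      swap : ∀ a b c → a * b * c ≡ a * c * b
      swap = solve-∀
    t∣B : t ∣ B
    t∣B = coprime-divisor (Coprimality.sym s⊥t) (divides D (trans cancelled (*-comm t D)))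
    conclude : t ∣ B → _
    conclude (divides h refl) = s , t , g , h , refl , refl , refl ,
      *-cancelˡ-≡ D (s * h) t {{m*n≢0⇒m≢0 t}} (trans (sym cancelled) (rotate s h t))
      where
      rotate : ∀ a b c → a * (b * c) ≡ c * (a * b)
      rotate = solve-∀

  -- The pairs with maximum `m`. The pair (m, m) occurs twice, which is harmless in an upper bound.
  axis : ℕ → List (ℕ × ℕ)
  axis m = map (m ,_) (range m) ++ map (_, m) (range m)

  length-axis : ∀ m → length (axis m) ≡ m + m
  length-axis m = trans (length-++ (map (m ,_) (range m)))
    (cong₂ _+_ (trans (length-map _ (range m)) (length-range m)) (trans (length-map _ (range m)) (length-range m)))

  ∈-axis : ∀ {s t} → 1 ≤ s → 1 ≤ t → (s , t) ∈ axis (s ⊔ t)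
  ∈-axis {s} {t} 1≤s 1≤t with ≤-total s t
  ... | inj₁ s≤t = subst (λ m → (s , t) ∈ axis m) (sym (m≤n⇒m⊔n≡n s≤t))
                     (∈-++⁺ʳ (map (t ,_) (range t)) (∈-map⁺ (_, t) (∈-range⁺ 1≤s s≤t)))
  ... | inj₂ t≤s = subst (λ m → (s , t) ∈ axis m) (sym (m≥n⇒m⊔n≡m t≤s))
                     (∈-++⁺ˡ (∈-map⁺ (s ,_) (∈-range⁺ 1≤t t≤s)))

  -- The first entry is m = max(s, t). Each of A, B, C, D is one of s, t times one of g, h, so all
  -- four are at most M exactly when g and h are at most M div m.
  quadruples : ℕ → List (ℕ × (ℕ × ℕ) × (ℕ × ℕ))
  quadruples M = range M ⊗ λ m → axis m ⊗ λ _ → square (M div m)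

  -- The term for m counts 2 m (M div m)². One factor is absorbed by m (M div m) ≤ M, and a harmonic
  -- sum is left.
  length-quadruples : ∀ k → length (quadruples (2 ^ k)) ≤ 2 * suc k * (2 ^ k * 2 ^ k)
  length-quadruples k = begin
    length (quadruples M)                 ≡⟨ length-⊗ (range M) (λ m → axis m ⊗ λ _ → square (M div m)) ⟩
    Σ[1⋯ M ] (λ m → length (axis m ⊗ λ _ → square (M div m)))
                                          ≤⟨ sum-mono (range M) (λ {m} _ → term≤ m) ⟩
    Σ[1⋯ M ] (λ m → 2 * M * (M div m))    ≡⟨ sum-*ˡ (2 * M) (M div_) (range M) ⟩
    2 * M * Σ[1⋯ M ] (M div_)             ≤⟨ *-monoʳ-≤ (2 * M) (Σ-div-≤ M k) ⟩
    2 * M * (suc k * M)                   ≡⟨ rearrange M (suc k) ⟩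
    2 * suc k * (M * M)                   ∎
    where
    open ≤-Reasoning
    M = 2 ^ k
    rearrange : ∀ m k → 2 * m * (k * m) ≡ 2 * k * (m * m)
    rearrange = solve-∀
    term≤ : ∀ m → length (axis m ⊗ λ _ → square (M div m)) ≤ 2 * M * (M div m)
    term≤ m = begin
      length (axis m ⊗ λ _ → square q)  ≡⟨ length-⊗-const (axis m) (λ _ → square q) (λ _ → length-square q) ⟩
      length (axis m) * (q * q)         ≡⟨ cong (_* (q * q)) (length-axis m) ⟩
      (m + m) * (q * q)                 ≡⟨ identity m q ⟩
      2 * (q * m) * q                   ≤⟨ *-monoˡ-≤ q (*-monoʳ-≤ 2 (m-div-n*n≤m M m)) ⟩
      2 * M * q                         ∎
      where
      q = M div m
      identity : ∀ m q → (m + m) * (q * q) ≡ 2 * (q * m) * q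
      identity = solve-∀

  -- With C = t g = y - x and D = s h = y + x, the root x is half of D - C and a₁ is C D; likewise z
  -- is half of B - A.
  square-cube : ℕ × (ℕ × ℕ) × (ℕ × ℕ) → ℕ × Vec ℕ 2
  square-cube (_ , (s , t) , (g , h)) =
    let x = (s * h ∸ t * g) div 2
        z = (h * t ∸ s * g) div 2
    in x * x , t * g * (s * h) ∷ z * z ∸ x * x ∷ []

  module _ (N i : ℕ) (P²≤N : 2 ^ i * 2 ^ i ≤ N) (N<4P² : N < 4 * (2 ^ i * 2 ^ i)) where
    open ≤-Reasoning

    private
      P = 2 ^ i
      -- The largest root has w² ≤ 3 N ≤ 12 P², so w ≤ 4 P, and sums of two roots are at most 8 P.
      M = 2 ^ (3 + i)

    cubes⊆quadruples : ∀ {t} → t ∈ cubes 2 N → ∃ λ q → q ∈ quadruples M × t ≡ square-cube q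
    cubes⊆quadruples {a₀ , a₁ ∷ a₂ ∷ []} t∈
      with a₀≤N , bounds , cube⊆ ← ∈-cubes⁻ N t∈
      with x , refl ← origin-root cube⊆ | y , y² ← edge-root cube⊆ | z , w , z² , w² ← face-roots cube⊆ zero
      with C , refl , a₁≡DC ← w²∸z² {a₁} {x} {y} y²
         | A , refl , a₁≡BA ← w²∸z² {a₁} {z} {w} (trans (cong (_+ a₁) (sym z²)) (trans (a+b+c≡a+[c+b] (x * x) a₂ a₁) w²))
      = conclude (four-numbers {A} {B} {C} {D} (trans (*-comm A B) (trans (sym a₁≡BA) (trans a₁≡DC (*-comm D C)))))
      where
      B D : ℕ
      B = z + (z + A)
      D = x + (x + C)
      instance
        a₁≢0 : NonZero a₁
        a₁≢0 = >-nonZero (proj₁ (bounds zero))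
        A≢0 : NonZero A
        A≢0 = m*n≢0⇒n≢0 B {A} {{subst NonZero a₁≡BA a₁≢0}}
        C≢0 : NonZero C
        C≢0 = m*n≢0⇒n≢0 D {C} {{subst NonZero a₁≡DC a₁≢0}}
      w≤4P : z + A ≤ 4 * P
      w≤4P = a²≤b²⇒a≤b (begin
        (z + A) * (z + A)                        ≡⟨ w² ⟨
        x * x + (a₁ + a₂)                        ≤⟨ +-mono-≤ a₀≤N (+-mono-≤ (proj₂ (bounds zero)) (proj₂ (bounds (suc zero)))) ⟩
        N + (N + N)                              ≤⟨ +-mono-≤ N≤ (+-mono-≤ N≤ N≤) ⟩
        4 * (P * P) + (4 * (P * P) + 4 * (P * P))  ≤⟨ m≤m+n _ (4 * (P * P)) ⟩
        4 * (P * P) + (4 * (P * P) + 4 * (P * P)) + 4 * (P * P)  ≡⟨ identity P ⟩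
        4 * P * (4 * P)                          ∎)
        where
        N≤ = <⇒≤ N<4P²
        identity : ∀ p → 4 * (p * p) + (4 * (p * p) + 4 * (p * p)) + 4 * (p * p) ≡ 4 * p * (4 * p)
        identity = solve-∀
      y≤w : x + C ≤ z + A
      y≤w = a²≤b²⇒a≤b (subst₂ _≤_ y² w² (+-monoʳ-≤ (x * x) (m≤m+n a₁ a₂)))
      4P+4P≡M : 4 * P + 4 * P ≡ M
      4P+4P≡M = identity P
        where
        identity : ∀ p → 4 * p + 4 * p ≡ 2 * (2 * (2 * p))
        identity = solve-∀
      B≤M : B ≤ M
      B≤M = ≤-trans (+-mono-≤ (≤-trans (m≤m+n z A) w≤4P) w≤4P) (≤-reflexive 4P+4P≡M)
      D≤M : D ≤ M
      D≤M = ≤-trans (+-mono-≤ (≤-trans (m≤m+n x C) (≤-trans y≤w w≤4P)) (≤-trans y≤w w≤4P)) (≤-reflexive 4P+4P≡M)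
      A≤M : A ≤ M
      A≤M = ≤-trans (≤-trans (m≤n+m A z) (m≤n+m (z + A) z)) B≤M
      C≤M : C ≤ M
      C≤M = ≤-trans (≤-trans (m≤n+m C x) (m≤n+m (x + C) x)) D≤M
      conclude : (∃₂ λ s t → ∃₂ λ g h → A ≡ s * g × C ≡ t * g × B ≡ h * t × D ≡ s * h) →
                 ∃ λ q → q ∈ quadruples M × (x * x , a₁ ∷ a₂ ∷ []) ≡ square-cube q
      conclude (s , t , g , h , A≡ , C≡ , B≡ , D≡) =
        (s ⊔ t , (s , t) , (g , h))
        , ∈-⊗⁺ (∈-range⁺ (≤-trans 1≤s (m≤m⊔n s t)) (≤-trans (m≤n*m (s ⊔ t) g {{>-nonZero 1≤g}}) g*m≤M))
            (∈-⊗⁺ (∈-axis 1≤s 1≤t) (∈-⊗⁺ (∈-range⁺ 1≤g (k*n≤m⇒k≤m-div-n 1≤m g*m≤M)) (∈-range⁺ 1≤h (k*n≤m⇒k≤m-div-n 1≤m h*m≤M))))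
        , cong₂ _,_ (cong (λ x → x * x) (sym x≡)) (cong₂ _∷_ a₁≡ (cong (_∷ []) a₂≡))
        where
        instance
          sg≢0 : NonZero (s * g)
          sg≢0 = subst NonZero A≡ A≢0
          tg≢0 : NonZero (t * g)
          tg≢0 = subst NonZero C≡ C≢0
          sh≢0 : NonZero (s * h)
          sh≢0 = subst NonZero D≡ (m*n≢0⇒m≢0 D {C} {{subst NonZero a₁≡DC a₁≢0}})
        1≤s = >-nonZero⁻¹ s {{m*n≢0⇒m≢0 s {g}}}
        1≤t = >-nonZero⁻¹ t {{m*n≢0⇒m≢0 t {g}}}
        1≤g = >-nonZero⁻¹ g {{m*n≢0⇒n≢0 s {g}}}
        1≤h = >-nonZero⁻¹ h {{m*n≢0⇒n≢0 s {h}}}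
        1≤m = ≤-trans 1≤s (m≤m⊔n s t)
        g*m≤M : g * (s ⊔ t) ≤ M
        g*m≤M = subst (_≤ M) (sym (*-distribˡ-⊔ g s t))
          (⊔-lub (subst (_≤ M) (trans A≡ (*-comm s g)) A≤M) (subst (_≤ M) (trans C≡ (*-comm t g)) C≤M))
        h*m≤M : h * (s ⊔ t) ≤ M
        h*m≤M = subst (_≤ M) (sym (*-distribˡ-⊔ h s t))
          (⊔-lub (subst (_≤ M) (trans D≡ (*-comm s h)) D≤M) (subst (_≤ M) B≡ B≤M))
        x≡ : (s * h ∸ t * g) div 2 ≡ x
        x≡ = trans (cong₂ (λ u v → (u ∸ v) div 2) (sym D≡) (sym C≡)) ([z+z+e∸e]div2≡z x C)
        z≡ : (h * t ∸ s * g) div 2 ≡ z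
        z≡ = trans (cong₂ (λ u v → (u ∸ v) div 2) (sym B≡) (sym A≡)) ([z+z+e∸e]div2≡z z A)
        a₁≡ : a₁ ≡ t * g * (s * h)
        a₁≡ = trans a₁≡DC (trans (*-comm D C) (cong₂ _*_ C≡ D≡))
        a₂≡ : a₂ ≡ _
        a₂≡ = trans (sym (m+n∸m≡n (x * x) a₂)) (cong₂ _∸_ (trans z² (cong (λ z → z * z) (sym z≡))) (cong (λ x → x * x) (sym x≡)))

    H2≤ : H 2 N ≤ 128 * (4 + i) * N
    H2≤ = begin
      H 2 N                           ≡⟨ length-cubes 2 N ⟨
      length (cubes 2 N)              ≤⟨ surjection⇒length≤ square-cube (cubes-unique 2 N) cubes⊆quadruples ⟩
      length (quadruples M)           ≤⟨ length-quadruples (3 + i) ⟩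
      2 * (4 + i) * (M * M)           ≡⟨ identity (4 + i) P ⟩
      128 * (4 + i) * (P * P)         ≤⟨ *-monoʳ-≤ (128 * (4 + i)) P²≤N ⟩
      128 * (4 + i) * N               ∎
      where
      identity : ∀ k p → 2 * k * (2 * (2 * (2 * p)) * (2 * (2 * (2 * p)))) ≡ 128 * k * (p * p)
      identity = solve-∀

  -- Lower bound in dimension 2.

  coprime-pairs : ℕ → List (ℕ × ℕ)
  coprime-pairs R = range R ⊗ λ s → filter (coprime? s) (range s)

  -- Bounding g s and k s by R keeps every root of the resulting cube below 8 R.
  seeds : ℕ → List ((ℕ × ℕ) × (ℕ × ℕ))
  seeds R = coprime-pairs R ⊗ λ (s , _) → square (R div s)

  seeds-unique : ∀ R → Unique (seeds R)
  seeds-unique R = ⊗-unique (⊗-unique (range-unique R) (λ s → Unique.filter⁺ (coprime? s) (range-unique s)))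
                            (λ (s , _) → square-unique (R div s))

  ∈-coprime-pairs⁺ : ∀ {R s r} → s ≤ R → 1 ≤ r → r ≤ s → Coprime s r → (s , r) ∈ coprime-pairs R
  ∈-coprime-pairs⁺ {s = s} s≤R 1≤r r≤s s⊥r =
    ∈-⊗⁺ (∈-range⁺ (≤-trans 1≤r r≤s) s≤R) (∈-filter⁺ (coprime? s) (∈-range⁺ 1≤r r≤s) s⊥r)

  ∈-seeds⁻ : ∀ R {s r g k} → ((s , r) , (g , k)) ∈ seeds R →
    1 ≤ r × r ≤ s × Coprime s r × 1 ≤ g × 1 ≤ k × g * s ≤ R × k * s ≤ R
  ∈-seeds⁻ R {s} q∈
    with p∈ , gk∈ ← ∈-⊗⁻ (coprime-pairs R) q∈
    with _ , r∈ ← ∈-⊗⁻ (range R) p∈ | g∈ , k∈ ← ∈-⊗⁻ (range (R div s)) gk∈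
    with r∈range , s⊥r ← ∈-filter⁻ (coprime? s) {xs = range s} r∈
    = proj₁ (∈-range⁻ r∈range) , proj₂ (∈-range⁻ r∈range) , s⊥r , proj₁ (∈-range⁻ g∈) , proj₁ (∈-range⁻ k∈)
    , ≤-trans (*-monoˡ-≤ s (proj₂ (∈-range⁻ g∈))) (m-div-n*n≤m R s)
    , ≤-trans (*-monoˡ-≤ s (proj₂ (∈-range⁻ k∈))) (m-div-n*n≤m R s)

  -- Seeds without the coprimality condition; their number is an explicit sum of s (R div s)².
  all-pairs : ℕ → List (ℕ × ℕ × ℕ × ℕ)
  all-pairs R = range R ⊗ λ s → range s ⊗ λ _ → square (R div s)

  all-pairs-unique : ∀ R → Unique (all-pairs R)
  all-pairs-unique R = ⊗-unique (range-unique R) λ s → ⊗-unique (range-unique s) λ _ → square-unique (R div s)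

  -- For a coprime pair (s, r) and Q = R div s, these are the scalings e of the pair with the
  -- admissible (g, h): g s e ≤ R means g ≤ Q div e.
  multiples : ℕ → List (ℕ × ℕ × ℕ)
  multiples Q = range Q ⊗ λ e → square (Q div e)

  length-multiples : ∀ Q → length (multiples Q) ≤ 2 * (Q * Q)
  length-multiples Q = begin
    length (multiples Q)                       ≡⟨ length-⊗ (range Q) (λ e → square (Q div e)) ⟩
    Σ[1⋯ Q ] (λ e → length (square (Q div e))) ≤⟨ sum-mono (range Q) (λ {e} _ → ≤-reflexive (length-square (Q div e))) ⟩
    Σ-div² Q Q                                 ≤⟨ Σ-div²-≤ Q ⟩
    2 * (Q * Q)                                ∎
    where open ≤-Reasoning

  -- Write each pair as e (s , r) with s and r coprime; the sum over e converges.
  length-all-pairs≤2*length-seeds : ∀ R → length (all-pairs R) ≤ 2 * length (seeds R)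
  length-all-pairs≤2*length-seeds R = begin
    length (all-pairs R)                                              ≤⟨ surjection⇒length≤ scale (all-pairs-unique R) onto ⟩
    length scaled-seeds                                               ≡⟨ length-⊗ pairs (λ (s , _) → multiples (R div s)) ⟩
    sum (map (λ (s , _) → length (multiples (R div s))) pairs)        ≤⟨ sum-mono pairs (λ {(s , _)} _ → ≤-trans (length-multiples (R div s))
                                                                          (*-monoʳ-≤ 2 (≤-reflexive (sym (length-square (R div s)))))) ⟩
    sum (map (λ (s , _) → 2 * length (square (R div s))) pairs)       ≡⟨ sum-*ˡ 2 (λ (s , _) → length (square (R div s))) pairs ⟩
    2 * sum (map (λ (s , _) → length (square (R div s))) pairs)       ≡⟨ cong (2 *_) (length-⊗ pairs (λ (s , _) → square (R div s))) ⟨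
    2 * length (seeds R)                                              ∎
    where
    open ≤-Reasoning
    pairs = coprime-pairs R
    scaled-seeds = pairs ⊗ λ (s , _) → multiples (R div s)
    scale : (ℕ × ℕ) × ℕ × ℕ × ℕ → ℕ × ℕ × ℕ × ℕ
    scale ((s , r) , e , g , h) = s * e , r * e , g , h
    onto : ∀ {p} → p ∈ all-pairs R → ∃ λ q → q ∈ scaled-seeds × p ≡ scale q
    onto {a , b , g , h} p∈
      with a∈ , q∈ ← ∈-⊗⁻ (range R) p∈
      with b∈ , gh∈ ← ∈-⊗⁻ (range a) q∈
      with g∈ , h∈ ← ∈-⊗⁻ (range (R div a)) gh∈
      with e , s , r , e≢0 , refl , refl , s⊥r ← reduce a b {{>-nonZero (proj₁ (∈-range⁻ a∈))}}
      = ((s , r) , e , g , h)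
      , ∈-⊗⁺ (∈-coprime-pairs⁺ s≤R 1≤r r≤s s⊥r)
          (∈-⊗⁺ (∈-range⁺ 1≤e (k*n≤m⇒k≤m-div-n 1≤s (subst (_≤ R) (*-comm s e) se≤R)))
            (∈-⊗⁺ (∈-range⁺ (proj₁ (∈-range⁻ g∈)) (bound (proj₂ (∈-range⁻ g∈))))
                  (∈-range⁺ (proj₁ (∈-range⁻ h∈)) (bound (proj₂ (∈-range⁻ h∈))))))
      , refl
      where
      instance _ = e≢0
      1≤e = >-nonZero⁻¹ e
      se≤R = proj₂ (∈-range⁻ a∈)
      s≤R = ≤-trans (m≤m*n s e) se≤R
      r≤s : r ≤ s
      r≤s = *-cancelʳ-≤ r s e (proj₂ (∈-range⁻ b∈))
      1≤r : 1 ≤ r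
      1≤r = >-nonZero⁻¹ r {{m*n≢0⇒m≢0 r {e} {{>-nonZero (proj₁ (∈-range⁻ b∈))}}}}
      1≤s = ≤-trans 1≤r r≤s
      bound : ∀ {c} → c ≤ R div (s * e) → c ≤ (R div s) div e
      bound {c} c≤ = k*n≤m⇒k≤m-div-n 1≤e (k*n≤m⇒k≤m-div-n 1≤s (begin
        c * e * s             ≡⟨ rearrange c e s ⟩
        c * (s * e)           ≤⟨ *-monoˡ-≤ (s * e) c≤ ⟩
        R div (s * e) * (s * e) ≤⟨ m-div-n*n≤m R (s * e) ⟩
        R                     ∎))
        where
        rearrange : ∀ a b c → a * b * c ≡ a * (c * b)
        rearrange = solve-∀

  -- The 8 is 4 from the dyadic estimate times 2 from the restriction to coprime pairs.
  length-seeds : ∀ j → j * (2 ^ j * 2 ^ j) ≤ 8 * length (seeds (2 ^ j))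
  length-seeds j = begin
    j * (R * R)                    ≤⟨ Σ-weighted-≥ j j ≤-refl ⟩
    4 * Σ[1⋯ R ] (λ s → s * ((R div s) * (R div s)))
                                   ≤⟨ *-monoʳ-≤ 4 (sum-mono (range R) (λ {s} _ → ≤-reflexive (sym (length-term s)))) ⟩
    4 * Σ[1⋯ R ] (λ s → length (range s ⊗ λ _ → square (R div s)))
                                   ≡⟨ cong (4 *_) (length-⊗ (range R) (λ s → range s ⊗ λ _ → square (R div s))) ⟨
    4 * length (all-pairs R)       ≤⟨ *-monoʳ-≤ 4 (length-all-pairs≤2*length-seeds R) ⟩
    4 * (2 * length (seeds R))     ≡⟨ *-assoc 4 2 (length (seeds R)) ⟨
    8 * length (seeds R)           ∎
    where
    open ≤-Reasoning
    R = 2 ^ j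
    length-term : ∀ s → length (range s ⊗ λ _ → square (R div s)) ≡ s * ((R div s) * (R div s))
    length-term s = trans (length-⊗-const (range s) (λ _ → square (R div s)) (λ _ → length-square (R div s)))
                          (cong (_* ((R div s) * (R div s))) (length-range s))

  -- With s = r + u, t = s + r and h = 2 g + k, the roots are
  --   x = s h - g t,  y = s h + g t,  z = t h - g s,  w = t h + g s.
  module Seed (r u g k : ℕ) where
    s t h x y z w a₁ a₂ : ℕ
    s = r + u
    t = s + r
    h = g + g + k
    -- Subtraction-free: s h - g t = s (2 g + k) - g (s + r) = (s - r) g + s k.
    x = u * g + s * k
    y = x + 2 * (g * t)
    z = s * g + (r + r) * g + t * k
    w = z + 2 * (g * s)
    a₁ = 4 * (g * t * (s * h))
    -- This is (z - x)(z + x), visibly positive in this form.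
    a₂ = r * (g + h) * ((s + t) * (g + k))

    sh≡x+gt : s * h ≡ x + g * t
    sh≡x+gt = identity r u g k
      where
      identity : ∀ r u g k → (r + u) * (g + g + k) ≡ u * g + (r + u) * k + g * (r + u + r)
      identity = solve-∀

    th≡z+gs : t * h ≡ z + g * s
    th≡z+gs = identity s r g k
      where
      identity : ∀ s r g k → (s + r) * (g + g + k) ≡ s * g + (r + r) * g + (s + r) * k + g * s
      identity = solve-∀

    z≡x+r[g+h] : z ≡ x + r * (g + h)
    z≡x+r[g+h] = identity r u g k
      where
      identity : ∀ r u g k → (r + u) * g + (r + r) * g + (r + u + r) * k ≡ u * g + (r + u) * k + r * (g + (g + g + k))
      identity = solve-∀

    z+x≡[s+t][g+k] : z + x ≡ (s + t) * (g + k)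
    z+x≡[s+t][g+k] = identity r u g k
      where
      identity : ∀ r u g k → (r + u) * g + (r + r) * g + (r + u + r) * k + (u * g + (r + u) * k) ≡ (r + u + (r + u + r)) * (g + k)
      identity = solve-∀

    private
      n*n≡n^2 : ∀ n → n * n ≡ n ^ 2
      n*n≡n^2 n = cong (n *_) (sym (*-identityʳ n))

      4q[x+q] : ∀ x q → x * x + 4 * (q * (x + q)) ≡ (x + 2 * q) * (x + 2 * q)
      4q[x+q] = solve-∀

    x²+a₁≡y² : x * x + a₁ ≡ y * y
    x²+a₁≡y² = trans (cong (λ p → x * x + 4 * (g * t * p)) sh≡x+gt) (4q[x+q] x (g * t))

    z²+a₁≡w² : z * z + a₁ ≡ w * w
    z²+a₁≡w² = trans (cong (λ p → z * z + 4 * p) (trans (swap g t s h) (cong (g * s *_) th≡z+gs))) (4q[x+q] z (g * s))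
      where
      swap : ∀ g t s h → g * t * (s * h) ≡ g * s * (t * h)
      swap = solve-∀

    x²+a₂≡z² : x * x + a₂ ≡ z * z
    x²+a₂≡z² = begin
      x * x + e * ((s + t) * (g + k))   ≡⟨ cong (λ p → x * x + e * p) z+x≡[s+t][g+k] ⟨
      x * x + e * (z + x)               ≡⟨ cong (λ z → x * x + e * (z + x)) z≡x+r[g+h] ⟩
      x * x + e * (x + e + x)           ≡⟨ identity x e ⟩
      (x + e) * (x + e)                 ≡⟨ cong₂ _*_ z≡x+r[g+h] z≡x+r[g+h] ⟨
      z * z                             ∎
      where
      open ≡-Reasoning
      e = r * (g + h)
      identity : ∀ x e → x * x + e * (x + e + x) ≡ (x + e) * (x + e)
      identity = solve-∀

    x²+[a₁+a₂]≡w² : x * x + (a₁ + a₂) ≡ w * w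
    x²+[a₁+a₂]≡w² = begin
      x * x + (a₁ + a₂)   ≡⟨ a+b+c≡a+[c+b] (x * x) a₂ a₁ ⟨
      x * x + a₂ + a₁     ≡⟨ cong (_+ a₁) x²+a₂≡z² ⟩
      z * z + a₁          ≡⟨ z²+a₁≡w² ⟩
      w * w               ∎
      where open ≡-Reasoning

    cube : ℕ × Vec ℕ 2
    cube = x * x , a₁ ∷ a₂ ∷ []

    cube⊆squares : HilbertCube (x * x) (a₁ ∷ a₂ ∷ []) ⊆ Squares
    cube⊆squares (zero ∷ zero ∷ [] , refl)         = x , trans (+-identityʳ (x * x)) (n*n≡n^2 x)
    cube⊆squares (zero ∷ suc zero ∷ [] , refl)     = z , trans (right (x * x) a₂) (trans x²+a₂≡z² (n*n≡n^2 z))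
      where
      right : ∀ a b → a + (b + 0 + 0) ≡ a + b
      right = solve-∀
    cube⊆squares (suc zero ∷ zero ∷ [] , refl)     = y , trans (left (x * x) a₁) (trans x²+a₁≡y² (n*n≡n^2 y))
      where
      left : ∀ a b → a + (b + 0 + 0) ≡ a + b
      left = solve-∀
    cube⊆squares (suc zero ∷ suc zero ∷ [] , refl) = w , trans (both (x * x) a₁ a₂) (trans x²+[a₁+a₂]≡w² (n*n≡n^2 w))
      where
      both : ∀ a b c → a + (b + 0 + (c + 0 + 0)) ≡ a + (b + c)
      both = solve-∀

    w≤7sq : ∀ {q} → r ≤ s → g * s ≤ q → k * s ≤ q → w ≤ 7 * q
    w≤7sq {q} r≤s gs≤q ks≤q = begin
      w                                          ≤⟨ +-monoˡ-≤ (2 * (g * s)) (+-mono-≤ (+-monoʳ-≤ (s * g) (*-monoˡ-≤ g (+-mono-≤ r≤s r≤s))) (*-monoˡ-≤ k (+-monoʳ-≤ s r≤s))) ⟩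
      s * g + (s + s) * g + (s + s) * k + 2 * (g * s) ≡⟨ identity s g k ⟩
      5 * (g * s) + 2 * (k * s)                  ≤⟨ +-mono-≤ (*-monoʳ-≤ 5 gs≤q) (*-monoʳ-≤ 2 ks≤q) ⟩
      5 * q + 2 * q                              ≡⟨ *-distribʳ-+ q 5 2 ⟨
      7 * q                                      ∎
      where
      open ≤-Reasoning
      identity : ∀ s g k → s * g + (s + s) * g + (s + s) * k + 2 * (g * s) ≡ 5 * (g * s) + 2 * (k * s)
      identity = solve-∀

    cube∈cubes : ∀ {N} → 1 ≤ r → 1 ≤ g → 1 ≤ k → w * w ≤ N → cube ∈ cubes 2 N
    cube∈cubes {N} 1≤r 1≤g 1≤k w²≤N = ∈-cubes⁺ (≤-trans (m≤m+n (x * x) (a₁ + a₂)) total≤N) bounds cube⊆squares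
      where
      total≤N : x * x + (a₁ + a₂) ≤ N
      total≤N = subst (_≤ N) (sym x²+[a₁+a₂]≡w²) w²≤N
      a₁+a₂≤N = ≤-trans (m≤n+m (a₁ + a₂) (x * x)) total≤N
      1≤s = m≤n⇒m≤n+o u 1≤r
      bounds : ∀ i → 1 ≤ lookup (a₁ ∷ a₂ ∷ []) i × lookup (a₁ ∷ a₂ ∷ []) i ≤ N
      bounds zero       = *-mono-≤ {1} {4} (s≤s z≤n) (*-mono-≤ (*-mono-≤ 1≤g (m≤n⇒m≤n+o r 1≤s)) (*-mono-≤ 1≤s (m≤n⇒m≤n+o k (m≤n⇒m≤n+o g 1≤g))))
                        , ≤-trans (m≤m+n a₁ a₂) a₁+a₂≤N
      bounds (suc zero) = *-mono-≤ (*-mono-≤ 1≤r (m≤n⇒m≤n+o h 1≤g)) (*-mono-≤ (m≤n⇒m≤n+o t 1≤s) (m≤n⇒m≤n+o k 1≤g))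
                        , ≤-trans (m≤n+m a₂ a₁) a₁+a₂≤N

  seed-cube : (ℕ × ℕ) × (ℕ × ℕ) → ℕ × Vec ℕ 2
  seed-cube ((s , r) , (g , k)) = Seed.cube r (s ∸ r) g k

  -- The equal fractions s / r and s′ / r′ are in lowest terms, so the numerators divide each other.
  proportional-coprime : ∀ {s r s′ r′} → Coprime s r → Coprime s′ r′ → s * r′ ≡ s′ * r → s ≡ s′
  proportional-coprime {s} {r} {s′} {r′} s⊥r s′⊥r′ eq = ∣-antisym
    (coprime-divisor s⊥r (divides r′ (trans (*-comm r s′) (trans (sym eq) (*-comm s r′)))))
    (coprime-divisor s′⊥r′ (divides r (trans (*-comm r′ s) (trans eq (*-comm s′ r)))))

  module _ (r u g k r′ u′ g′ k′ : ℕ)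
           .{{_ : NonZero r}} .{{_ : NonZero g}}
           (eq : Seed.cube r u g k ≡ Seed.cube r′ u′ g′ k′) where

    private
      module S = Seed r u g k
      module S′ = Seed r′ u′ g′ k′
      a₀≡ : S.x * S.x ≡ S′.x * S′.x
      a₀≡ = cong proj₁ eq
      a₁≡ : S.a₁ ≡ S′.a₁
      a₁≡ = cong (Vec.head ∘ proj₂) eq
      a₂≡ : S.a₂ ≡ S′.a₂
      a₂≡ = cong (Vec.head ∘ Vec.tail ∘ proj₂) eq
      x≡ : S.x ≡ S′.x
      x≡ = a²≡b²⇒a≡b a₀≡
      y≡ : S.y ≡ S′.y
      y≡ = a²≡b²⇒a≡b (trans (sym S.x²+a₁≡y²) (trans (cong₂ _+_ a₀≡ a₁≡) S′.x²+a₁≡y²))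
      z≡ : S.z ≡ S′.z
      z≡ = a²≡b²⇒a≡b (trans (sym S.x²+a₂≡z²) (trans (cong₂ _+_ a₀≡ a₂≡) S′.x²+a₂≡z²))
      w≡ : S.w ≡ S′.w
      w≡ = a²≡b²⇒a≡b (trans (sym S.z²+a₁≡w²) (trans (cong₂ _+_ (cong₂ _*_ z≡ z≡) a₁≡) S′.z²+a₁≡w²))
      half : ∀ {p p′ q q′} → p ≡ p′ → p + 2 * q ≡ p′ + 2 * q′ → q ≡ q′
      half {p} {_} {q} {q′} refl eq = *-cancelˡ-≡ q q′ 2 (+-cancelˡ-≡ p _ _ eq)
      gt≡ : g * S.t ≡ g′ * S′.t
      gt≡ = half x≡ y≡
      gs≡ : g * S.s ≡ g′ * S′.s
      gs≡ = half z≡ w≡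
      sh≡ : S.s * S.h ≡ S′.s * S′.h
      sh≡ = trans S.sh≡x+gt (trans (cong₂ _+_ x≡ gt≡) (sym S′.sh≡x+gt))
      gr≡ : g * r ≡ g′ * r′
      gr≡ = +-cancelˡ-≡ (g * S.s) _ _ (begin
        g * S.s + g * r       ≡⟨ *-distribˡ-+ g S.s r ⟨
        g * S.t               ≡⟨ gt≡ ⟩
        g′ * S′.t             ≡⟨ *-distribˡ-+ g′ S′.s r′ ⟩
        g′ * S′.s + g′ * r′   ≡⟨ cong (_+ g′ * r′) gs≡ ⟨
        g * S.s + g′ * r′     ∎)
        where open ≡-Reasoning
      sr′≡s′r : S.s * r′ ≡ S′.s * r
      sr′≡s′r = *-cancelˡ-≡ _ _ (g * g′) {{m*n≢0 g g′ {{it}} {{g′≢0}}}} (begin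
        g * g′ * (S.s * r′)      ≡⟨ swap g g′ S.s r′ ⟩
        g * S.s * (g′ * r′)      ≡⟨ cong₂ _*_ gs≡ (sym gr≡) ⟩
        g′ * S′.s * (g * r)      ≡⟨ swap g′ g S′.s r ⟨
        g′ * g * (S′.s * r)      ≡⟨ cong (_* (S′.s * r)) (*-comm g′ g) ⟩
        g * g′ * (S′.s * r)      ∎)
        where
        open ≡-Reasoning
        swap : ∀ a b c d → a * b * (c * d) ≡ a * c * (b * d)
        swap = solve-∀
        g′≢0 : NonZero g′
        g′≢0 = m*n≢0⇒m≢0 g′ {r′} {{subst NonZero gr≡ (m*n≢0 g r)}}

    -- The cube fixes its four roots, hence g t = (y - x)/2, g s = (w - z)/2 and the difference g r.
    -- The ratio s : r in lowest terms gives s and r; then g follows from g s, and h, hence k, from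
    -- s h.
    Seed-injective : Coprime S.s r → Coprime S′.s r′ → S.s ≡ S′.s × r ≡ r′ × g ≡ g′ × k ≡ k′
    Seed-injective s⊥r s′⊥r′ = s≡ , r≡ , g≡ , k≡
      where
      s≢0 : NonZero S.s
      s≢0 = >-nonZero (m≤n⇒m≤n+o u (>-nonZero⁻¹ r))
      s≡ : S.s ≡ S′.s
      s≡ = proportional-coprime s⊥r s′⊥r′ sr′≡s′r
      r≡ : r ≡ r′
      r≡ = sym (*-cancelˡ-≡ r′ r S.s {{s≢0}} (trans sr′≡s′r (cong (_* r) (sym s≡))))
      g≡ : g ≡ g′
      g≡ = *-cancelʳ-≡ g g′ S.s {{s≢0}} (trans gs≡ (cong (g′ *_) (sym s≡)))
      h≡ : S.h ≡ S′.h
      h≡ = *-cancelˡ-≡ S.h S′.h S.s {{s≢0}} (trans sh≡ (cong (_* S′.h) (sym s≡)))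
      k≡ : k ≡ k′
      k≡ = +-cancelˡ-≡ (g + g) k k′ (trans h≡ (cong (λ g → g + g + k′) (sym g≡)))

  module _ (N j : ℕ) (64R²≤N : 64 * (2 ^ j * 2 ^ j) ≤ N) where
    open ≤-Reasoning

    private
      R = 2 ^ j

    seed-cube∈cubes : ∀ {q} → q ∈ seeds R → seed-cube q ∈ cubes 2 N
    seed-cube∈cubes {(s , r) , (g , k)} q∈
      with 1≤r , r≤s , _ , 1≤g , 1≤k , gs≤R , ks≤R ← ∈-seeds⁻ R q∈
      = Seed.cube∈cubes r u g k 1≤r 1≤g 1≤k (begin
        w * w                  ≤⟨ *-mono-≤ w≤8R w≤8R ⟩
        8 * R * (8 * R)        ≡⟨ identity R ⟩
        64 * (R * R)           ≤⟨ 64R²≤N ⟩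
        N                      ∎)
      where
      u = s ∸ r
      w = Seed.w r u g k
      r+u≡s : r + u ≡ s
      r+u≡s = m+[n∸m]≡n r≤s
      -- Rounding 7 up to 8 makes the bound a power of two, to be matched with the dyadic root of N.
      w≤8R : w ≤ 8 * R
      w≤8R = ≤-trans (Seed.w≤7sq r u g k (m≤m+n r u) (subst (λ s → g * s ≤ R) (sym r+u≡s) gs≤R) (subst (λ s → k * s ≤ R) (sym r+u≡s) ks≤R))
                     (*-monoˡ-≤ R (n≤1+n 7))
      identity : ∀ a → 8 * a * (8 * a) ≡ 64 * (a * a)
      identity = solve-∀

    seed-cube-injective : ∀ {q q′} → q ∈ seeds R → q′ ∈ seeds R → seed-cube q ≡ seed-cube q′ → q ≡ q′
    seed-cube-injective {(s , r) , (g , k)} {(s′ , r′) , (g′ , k′)} q∈ q′∈ eq =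
      conclude (∈-seeds⁻ R q∈) (∈-seeds⁻ R q′∈)
      where
      conclude : 1 ≤ r × r ≤ s × Coprime s r × 1 ≤ g × _ → _ × r′ ≤ s′ × Coprime s′ r′ × _ →
                 ((s , r) , (g , k)) ≡ ((s′ , r′) , (g′ , k′))
      conclude (1≤r , r≤s , s⊥r , 1≤g , _) (_ , r′≤s′ , s′⊥r′ , _) =
        let r+[s∸r]≡s = m+[n∸m]≡n r≤s
            r′+[s′∸r′]≡s′ = m+[n∸m]≡n r′≤s′
            s≡ , r≡ , g≡ , k≡ = Seed-injective r (s ∸ r) g k r′ (s′ ∸ r′) g′ k′ {{>-nonZero 1≤r}} {{>-nonZero 1≤g}} eq
              (subst (λ s → Coprime s r) (sym r+[s∸r]≡s) s⊥r) (subst (λ s → Coprime s r′) (sym r′+[s′∸r′]≡s′) s′⊥r′)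
        in cong₂ _,_ (cong₂ _,_ (trans (sym r+[s∸r]≡s) (trans s≡ r′+[s′∸r′]≡s′)) r≡) (cong₂ _,_ g≡ k≡)

    ≤H2 : j * (R * R) ≤ 8 * H 2 N
    ≤H2 = begin
      j * (R * R)              ≤⟨ length-seeds j ⟩
      8 * length (seeds R)     ≤⟨ *-monoʳ-≤ 8 (injection⇒length≤ seed-cube (seeds-unique R) seed-cube∈cubes seed-cube-injective) ⟩
      8 * length (cubes 2 N)   ≡⟨ cong (8 *_) (length-cubes 2 N) ⟩
      8 * H 2 N                ∎

  -- The two bounds in terms of exponents of two.

  module _ (N : ℕ) .{{_ : NonZero N}} (1024≤N : 1024 ≤ N) where
    open ≤-Reasoning

    -- Since 1024 = 4 · 16², a dyadic root with exponent at most 4 is excluded. An exponent 5 + j =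
    -- 3 + (2 + j) lets P be 8 R with R = 2^(2 + j), whose exponent is at least 2.
    scale : ∃ λ j → 2 ^ (5 + j) * 2 ^ (5 + j) ≤ N × N < 4 * (2 ^ (5 + j) * 2 ^ (5 + j))
    scale with i , lower , upper ← dyadic-root N with 5 ≤? i
    ... | yes 5≤i with j , refl ← m≤n⇒∃[o]m+o≡n 5≤i = j , lower , upper
    ... | no  5≰i = ⊥-elim (<⇒≱ upper (≤-trans (*-monoʳ-≤ 4 (*-mono-≤ 2^i≤16 2^i≤16)) 1024≤N))
      where
      2^i≤16 : 2 ^ i ≤ 2 ^ 4
      2^i≤16 = ^-monoʳ-≤ 2 (≤-pred (≰⇒> 5≰i))

    -- `H2≤` at exponent 5 + j gives the factor 4 + (5 + j) = 9 + j. The first inequality, from 10 +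
    -- j ≤ 10 + 2 j, is what later bounds this factor by a multiple of log N.
    H2-upper : ∃ λ i → 2 ^ suc i ≤ N × H 2 N ≤ 128 * i * N
    H2-upper with j , P²≤N , N<4P² ← scale = 9 + j , (begin
      2 ^ (10 + j)                   ≤⟨ ^-monoʳ-≤ 2 (+-monoʳ-≤ 5 (m≤n+m (5 + j) j)) ⟩
      2 ^ (5 + j + (5 + j))          ≡⟨ ^-distribˡ-+-* 2 (5 + j) (5 + j) ⟩
      2 ^ (5 + j) * 2 ^ (5 + j)      ≤⟨ P²≤N ⟩
      N                              ∎) , (H2≤ N (5 + j) P²≤N N<4P²)

    -- When N ≤ 2^e, 2 + e bounds every partial sum of log N. The constant collects N ≤ 4 · 64 R², 2
    -- + e ≤ 7 j and the 8 of `≤H2`.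
    H2-lower : ∃ λ e → N ≤ 2 ^ e × N * (2 + e) ≤ 4 * 64 * 7 * 8 * H 2 N
    H2-lower = let j , P²≤N , N<4P² = scale in
      bound (2 + j) (s≤s (s≤s z≤n)) (2 ^ (5 + j)) (^-distribˡ-+-* 2 3 (2 + j)) P²≤N N<4P²
      where
      8r*8r≡64r² : ∀ r → 8 * r * (8 * r) ≡ 64 * (r * r)
      8r*8r≡64r² = solve-∀
      4*2^n : ∀ n → 4 * 2 ^ n ≡ 2 ^ (2 + n)
      4*2^n n = quadruple (2 ^ n)
        where
        quadruple : ∀ a → 4 * a ≡ 2 * (2 * a)
        quadruple = solve-∀
      -- The left side is 2 + e for the `e` chosen below; j ≥ 2 turns the additive 10 into 5 j.
      e≤ : ∀ j → 2 ≤ j → 2 + (2 + (3 + j + (3 + j))) ≤ 7 * j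
      e≤ j 2≤j = begin
        2 + (2 + (3 + j + (3 + j)))    ≡⟨ identity j ⟩
        2 * j + 5 * 2                  ≤⟨ +-monoʳ-≤ (2 * j) (*-monoʳ-≤ 5 2≤j) ⟩
        2 * j + 5 * j                  ≡⟨ *-distribʳ-+ j 2 5 ⟨
        7 * j                          ∎
        where
        identity : ∀ j → 2 + (2 + (3 + j + (3 + j))) ≡ 2 * j + 10
        identity = solve-∀
      combine : ∀ α β γ n e j q h → n ≤ α * q → e ≤ β * j → j * q ≤ γ * h → n * e ≤ α * β * γ * h
      combine α β γ n e j q h n≤ e≤ jq≤ = begin
        n * e                ≤⟨ *-mono-≤ n≤ e≤ ⟩
        α * q * (β * j)      ≡⟨ swap α q β j ⟩
        α * β * (j * q)      ≤⟨ *-monoʳ-≤ (α * β) jq≤ ⟩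
        α * β * (γ * h)      ≡⟨ *-assoc (α * β) γ h ⟨
        α * β * γ * h        ∎
        where
        swap : ∀ a b c d → a * b * (c * d) ≡ a * c * (d * b)
        swap = solve-∀
      bound : ∀ j → 2 ≤ j → ∀ P → P ≡ 8 * 2 ^ j → P * P ≤ N → N < 4 * (P * P) →
              ∃ λ e → N ≤ 2 ^ e × N * (2 + e) ≤ 4 * 64 * 7 * 8 * H 2 N
      bound j 2≤j P P≡8R P²≤N N<4P² = e , N≤2^e
        , combine (4 * 64) 7 8 N (2 + e) j (R * R) (H 2 N) N≤256R² (e≤ j 2≤j) (≤H2 N j (subst (_≤ N) P²≡64R² P²≤N))
        where
        e = 2 + (3 + j + (3 + j))
        R = 2 ^ j
        P²≡64R² : P * P ≡ 64 * (R * R)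
        P²≡64R² = trans (cong₂ _*_ P≡8R P≡8R) (8r*8r≡64r² R)
        N≤256R² : N ≤ 4 * 64 * (R * R)
        N≤256R² = ≤-trans (<⇒≤ N<4P²) (≤-reflexive (trans (cong (4 *_) P²≡64R²) (sym (*-assoc 4 64 (R * R)))))
        P≡2^[3+j] : P ≡ 2 ^ (3 + j)
        P≡2^[3+j] = trans P≡8R (sym (^-distribˡ-+-* 2 3 j))
        N≤2^e : N ≤ 2 ^ e
        N≤2^e = begin
          N                                  ≤⟨ <⇒≤ N<4P² ⟩
          4 * (P * P)                        ≡⟨ cong (4 *_) (cong₂ _*_ P≡2^[3+j] P≡2^[3+j]) ⟩
          4 * (2 ^ (3 + j) * 2 ^ (3 + j))    ≡⟨ cong (4 *_) (^-distribˡ-+-* 2 (3 + j) (3 + j)) ⟨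
          4 * 2 ^ (3 + j + (3 + j))          ≡⟨ 4*2^n (3 + j + (3 + j)) ⟩
          2 ^ e                              ∎

  -- Powers of the count in every dimension.

  H-constant : ℕ → ℕ → ℕ
  H-constant d k = τ-constant (d * k) * 16 ^ suc k

  H-constant≢0 : ∀ d k → NonZero (H-constant d k)
  H-constant≢0 d k = m*n≢0 (τ-constant (d * k)) (16 ^ suc k) {{τ-constant≢0 (d * k)}} {{m^n≢0 16 (suc k)}}

  -- The k-th power of 16 N τ(n)^d contains τ(n)^(d k), which is at most a constant times n ≤ 16 N:
  -- a single further factor 16 N, hence the exponent 1 + 1/k.
  H^k≤C*N^[1+k] : ∀ d k N .{{_ : NonZero N}} → H (suc d) N ^ k ≤ H-constant d k * N ^ suc k
  H^k≤C*N^[1+k] d k N = let n , n≢0 , n≤16N , bound = H≤16N*τ^d d N in begin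
    H (suc d) N ^ k                            ≤⟨ ^-monoˡ-≤ k bound ⟩
    (16 * N * τ n ^ d) ^ k                     ≡⟨ ^-distribʳ-* k (16 * N) (τ n ^ d) ⟩
    (16 * N) ^ k * (τ n ^ d) ^ k               ≡⟨ cong ((16 * N) ^ k *_) (^-*-assoc (τ n) d k) ⟩
    (16 * N) ^ k * τ n ^ (d * k)               ≤⟨ *-monoʳ-≤ ((16 * N) ^ k) (≤-trans (τ^k≤C*n (d * k) n {{n≢0}}) (*-monoʳ-≤ E n≤16N)) ⟩
    (16 * N) ^ k * (E * (16 * N))              ≡⟨ rotate ((16 * N) ^ k) E (16 * N) ⟩
    E * (16 * N) ^ suc k                       ≡⟨ cong (E *_) (^-distribʳ-* (suc k) 16 N) ⟩
    E * (16 ^ suc k * N ^ suc k)               ≡⟨ *-assoc E (16 ^ suc k) (N ^ suc k) ⟨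
    E * 16 ^ suc k * N ^ suc k                 ∎
    where
    open ≤-Reasoning
    E = τ-constant (d * k)
    rotate : ∀ a b c → a * (b * c) ≡ b * (c * a)
    rotate = solve-∀

  -- The hypothesis says 1 + 1/k ≤ a/b. C^b is enlarged to C^(k b) so that, once N^a ≤ q^b is used,
  -- the right side is a (k b)-th power.
  H^[k*b]≤C^[k*b]*N^[a*k] : ∀ d k .{{_ : NonZero k}} N .{{_ : NonZero N}} a b → suc k * b ≤ k * a →
    H (suc d) N ^ (k * b) ≤ H-constant d k ^ (k * b) * (N ^ a) ^ k
  H^[k*b]≤C^[k*b]*N^[a*k] d k N a b [1+k]b≤ka = begin
    H (suc d) N ^ (k * b)                      ≡⟨ ^-*-assoc (H (suc d) N) k b ⟨
    (H (suc d) N ^ k) ^ b                      ≤⟨ ^-monoˡ-≤ b (H^k≤C*N^[1+k] d k N) ⟩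
    (C * N ^ suc k) ^ b                        ≡⟨ ^-distribʳ-* b C (N ^ suc k) ⟩
    C ^ b * (N ^ suc k) ^ b                    ≡⟨ cong (C ^ b *_) (^-*-assoc N (suc k) b) ⟩
    C ^ b * N ^ (suc k * b)                    ≤⟨ *-mono-≤ (^-monoʳ-≤ C {{H-constant≢0 d k}} (m≤n*m b k)) (^-monoʳ-≤ N [1+k]b≤ka) ⟩
    C ^ (k * b) * N ^ (k * a)                  ≡⟨ cong (λ e → C ^ (k * b) * N ^ e) (*-comm k a) ⟩
    C ^ (k * b) * N ^ (a * k)                  ≡⟨ cong (C ^ (k * b) *_) (^-*-assoc N a k) ⟨
    C ^ (k * b) * (N ^ a) ^ k                  ∎
    where
    open ≤-Reasoning
    C = H-constant d k

module Rationals where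
  open import Data.Integer as ℤ using (+_; -[1+_]; +≤+)
  import Data.Integer.Properties as ℤ
  open import Data.Nat as ℕ using (ℕ; zero; suc; NonZero)
  import Data.Nat.Properties as ℕ
  open import Data.Product using (∃; ∃₂; _×_; _,_; proj₁; proj₂)
  open import Data.Rational hiding (NonZero)
  open import Data.Rational.Properties
  open import Data.Rational.Solver using (module +-*-Solver)
  import Data.Rational.Unnormalised as ℚᵘ
  import Data.Rational.Unnormalised.Properties as ℚᵘ
  open import Data.Sum using (inj₁; inj₂)
  open import Relation.Binary.PropositionalEquality
  open import Defs
  open Naturals using (H2-lower; H2-upper; H-constant; H-constant≢0; H^[k*b]≤C^[k*b]*N^[a*k])

  open ≤-Reasoning

  -- Natural numbers inside the rationals.

  toℚᵘ-ℕ→ℚ : ∀ n → toℚᵘ (ℕ→ℚ n) ℚᵘ.≃ ℚᵘ.mkℚᵘ (+ n) 0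
  toℚᵘ-ℕ→ℚ n = toℚᵘ-fromℚᵘ (ℚᵘ.mkℚᵘ (+ n) 0)

  ℕ→ℚ-+ : ∀ m n → ℕ→ℚ (m ℕ.+ n) ≡ ℕ→ℚ m + ℕ→ℚ n
  ℕ→ℚ-+ m n = toℚᵘ-injective (ℚᵘ.≃-trans (toℚᵘ-ℕ→ℚ (m ℕ.+ n)) (ℚᵘ.≃-sym
    (ℚᵘ.≃-trans (toℚᵘ-homo-+ (ℕ→ℚ m) (ℕ→ℚ n)) (ℚᵘ.≃-trans (ℚᵘ.+-cong (toℚᵘ-ℕ→ℚ m) (toℚᵘ-ℕ→ℚ n))
    (ℚᵘ.*≡* (cong (ℤ._* + 1) (cong₂ ℤ._+_ (ℤ.*-identityʳ (+ m)) (ℤ.*-identityʳ (+ n)))))))))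

  ℕ→ℚ-* : ∀ m n → ℕ→ℚ (m ℕ.* n) ≡ ℕ→ℚ m * ℕ→ℚ n
  ℕ→ℚ-* m n = toℚᵘ-injective (ℚᵘ.≃-trans (toℚᵘ-ℕ→ℚ (m ℕ.* n)) (ℚᵘ.≃-sym
    (ℚᵘ.≃-trans (toℚᵘ-homo-* (ℕ→ℚ m) (ℕ→ℚ n)) (ℚᵘ.≃-trans (ℚᵘ.*-cong (toℚᵘ-ℕ→ℚ m) (toℚᵘ-ℕ→ℚ n))
    (ℚᵘ.*≡* (cong (ℤ._* + 1) (sym (ℤ.pos-* m n))))))))

  ℕ→ℚ-^ : ∀ m n → ℕ→ℚ (m ℕ.^ n) ≡ ℕ→ℚ m ^ℚ n
  ℕ→ℚ-^ m zero    = refl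
  ℕ→ℚ-^ m (suc n) = trans (ℕ→ℚ-* m (m ℕ.^ n)) (cong (ℕ→ℚ m *_) (ℕ→ℚ-^ m n))

  ℕ→ℚ-mono : ∀ {m n} → m ℕ.≤ n → ℕ→ℚ m ≤ ℕ→ℚ n
  ℕ→ℚ-mono {m} {n} m≤n = toℚᵘ-cancel-≤ (ℚᵘ.≤-respˡ-≃ (ℚᵘ.≃-sym (toℚᵘ-ℕ→ℚ m))
    (ℚᵘ.≤-respʳ-≃ (ℚᵘ.≃-sym (toℚᵘ-ℕ→ℚ n)) (ℚᵘ.*≤* (ℤ.*-monoʳ-≤-nonNeg (+ 1) (+≤+ m≤n)))))

  ℕ→ℚ-nonNeg : ∀ n → NonNegative (ℕ→ℚ n)
  ℕ→ℚ-nonNeg n = normalize-nonNeg n 1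

  b/[1+a]≤1 : ∀ {a b} → b ℕ.≤ suc a → ℕ→ℚ b * (+ 1 / suc a) ≤ 1ℚ
  b/[1+a]≤1 {a} {b} b≤1+a = begin
    ℕ→ℚ b * (+ 1 / suc a)        ≤⟨ *-monoʳ-≤-nonNeg (+ 1 / suc a) {{1/N-nonNeg (suc a)}} (ℕ→ℚ-mono b≤1+a) ⟩
    ℕ→ℚ (suc a) * (+ 1 / suc a)  ≡⟨ N*1/N≡1 (suc a) ⟩
    1ℚ                           ∎

  -- Partial sums of log N between multiples of the dyadic exponent.

  module _ (N : ℕ) .{{_ : NonZero N}} where
    open Log N using (L; L-mono; tail; pow-nonNeg; pow≤1; x≤1; νu-nonNeg; ν) renaming (x to y)
    open +-*-Solver

    private
      term : ℕ → ℚ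
      term k = y ^ℚ suc k * (+ 1 / suc k)

    L-block-≤ : ∀ a b {c} → (∀ k → a ℕ.≤ k → term k ≤ c) → L (b ℕ.+ a) ≤ L a + ℕ→ℚ b * c
    L-block-≤ a zero    {c} _     = ≤-reflexive (solve 2 (λ l c → l := l :+ con 0ℚ :* c) refl (L a) c)
    L-block-≤ a (suc b) {c} bound = begin
      L (b ℕ.+ a) + term (b ℕ.+ a)  ≤⟨ +-mono-≤ (L-block-≤ a b bound) (bound _ (ℕ.m≤n+m a b)) ⟩
      L a + ℕ→ℚ b * c + c           ≡⟨ solve 3 (λ l b c → l :+ b :* c :+ c := l :+ (con 1ℚ :+ b) :* c) refl (L a) (ℕ→ℚ b) c ⟩
      L a + (1ℚ + ℕ→ℚ b) * c        ≡⟨ cong (λ t → L a + t * c) (ℕ→ℚ-+ 1 b) ⟨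
      L a + ℕ→ℚ (suc b) * c         ∎

    L-block-≥ : ∀ a b {c} → (∀ k → k ℕ.< b ℕ.+ a → c ≤ term k) → L a + ℕ→ℚ b * c ≤ L (b ℕ.+ a)
    L-block-≥ a zero    {c} _     = ≤-reflexive (solve 2 (λ l c → l :+ con 0ℚ :* c := l) refl (L a) c)
    L-block-≥ a (suc b) {c} bound = begin
      L a + ℕ→ℚ (suc b) * c         ≡⟨ cong (λ t → L a + t * c) (ℕ→ℚ-+ 1 b) ⟩
      L a + (1ℚ + ℕ→ℚ b) * c        ≡⟨ solve 3 (λ l b c → l :+ (con 1ℚ :+ b) :* c := l :+ b :* c :+ c) refl (L a) (ℕ→ℚ b) c ⟩
      L a + ℕ→ℚ b * c + c           ≤⟨ +-mono-≤ (L-block-≥ a b (λ k k< → bound k (ℕ.m≤n⇒m≤1+n k<))) (bound _ ℕ.≤-refl) ⟩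
      L (b ℕ.+ a) + term (b ℕ.+ a)  ∎

    term≤ : ∀ {a} k → a ℕ.≤ k → term k ≤ + 1 / suc a
    term≤ {a} k a≤k = begin
      y ^ℚ suc k * (+ 1 / suc k)  ≤⟨ *-monoʳ-≤-nonNeg (+ 1 / suc k) {{1/N-nonNeg (suc k)}} (pow≤1 (suc k)) ⟩
      1ℚ * (+ 1 / suc k)          ≡⟨ *-identityˡ (+ 1 / suc k) ⟩
      + 1 / suc k                 ≤⟨ 1/-anti a≤k ⟩
      + 1 / suc a                 ∎

    -- Bounding the powers of 1 - 1/N by 1 leaves a harmonic sum, whose dyadic blocks are at most 1
    -- each.
    L[2^i]≤1+i : ∀ i → L (2 ℕ.^ i) ≤ ℕ→ℚ (suc i)
    L[2^i]≤1+i zero    = begin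
      0ℚ + y ^ℚ 1 * 1ℚ   ≡⟨ solve 1 (λ t → con 0ℚ :+ t :* con 1ℚ := t) refl (y ^ℚ 1) ⟩
      y ^ℚ 1             ≤⟨ pow≤1 1 ⟩
      1ℚ                 ∎
    L[2^i]≤1+i (suc i) = begin
      L (2 ℕ.^ suc i)                   ≡⟨ cong (λ n → L (2 ℕ.^ i ℕ.+ n)) (ℕ.+-identityʳ (2 ℕ.^ i)) ⟩
      L (2 ℕ.^ i ℕ.+ 2 ℕ.^ i)           ≤⟨ L-block-≤ (2 ℕ.^ i) (2 ℕ.^ i) term≤ ⟩
      L (2 ℕ.^ i) + ℕ→ℚ (2 ℕ.^ i) * (+ 1 / suc (2 ℕ.^ i))
                                        ≤⟨ +-mono-≤ (L[2^i]≤1+i i) (b/[1+a]≤1 {2 ℕ.^ i} (ℕ.n≤1+n (2 ℕ.^ i))) ⟩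
      ℕ→ℚ (suc i) + 1ℚ                  ≡⟨ +-comm (ℕ→ℚ (suc i)) 1ℚ ⟩
      1ℚ + ℕ→ℚ (suc i)                  ≡⟨ ℕ→ℚ-+ 1 (suc i) ⟨
      ℕ→ℚ (suc (suc i))                 ∎

    -- Past `m` the series is dominated by a geometric one with sum at most N / (m + 1) ≤ 1.
    L≤L+1 : ∀ {m} n → N ℕ.≤ suc m → L n ≤ L m + 1ℚ
    L≤L+1 {m} n N≤1+m with ℕ.≤-total n m
    ... | inj₁ n≤m = ≤-trans (L-mono (ℕ.≤⇒≤′ n≤m)) (p≤p+q (L m) (nonNegative⁻¹ 1ℚ))
    ... | inj₂ m≤n = begin
      L n                            ≤⟨ p≤p+q (L n) (nonNegative⁻¹ _ {{nonNeg*nonNeg⇒nonNeg w {{νu-nonNeg m}} (y ^ℚ suc n) {{pow-nonNeg (suc n)}}}}) ⟩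
      L n + w * y ^ℚ suc n           ≤⟨ tail (ℕ.≤⇒≤′ m≤n) ⟩
      L m + w * y ^ℚ suc m           ≤⟨ +-monoʳ-≤ (L m) (*-monoˡ-≤-nonNeg w {{νu-nonNeg m}} (pow≤1 (suc m))) ⟩
      L m + w * 1ℚ                   ≡⟨ cong (λ t → L m + t) (*-identityʳ w) ⟩
      L m + w                        ≤⟨ +-monoʳ-≤ (L m) (b/[1+a]≤1 N≤1+m) ⟩
      L m + 1ℚ                       ∎
      where w = ν * (+ 1 / suc m)

    logPartialSum≤ : ∀ J n → N ℕ.≤ 2 ℕ.^ J → L n ≤ ℕ→ℚ (2 ℕ.+ J)
    logPartialSum≤ J n N≤2^J = begin
      L n                  ≤⟨ L≤L+1 n (ℕ.m≤n⇒m≤1+n N≤2^J) ⟩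
      L (2 ℕ.^ J) + 1ℚ     ≤⟨ +-monoˡ-≤ 1ℚ (L[2^i]≤1+i J) ⟩
      ℕ→ℚ (suc J) + 1ℚ     ≡⟨ +-comm (ℕ→ℚ (suc J)) 1ℚ ⟩
      1ℚ + ℕ→ℚ (suc J)     ≡⟨ ℕ→ℚ-+ 1 (suc J) ⟨
      ℕ→ℚ (2 ℕ.+ J)        ∎

    bernoulli : ∀ k → 1ℚ ≤ y ^ℚ k + ℕ→ℚ k * (+ 1 / N)
    bernoulli zero    = ≤-reflexive (solve 1 (λ u → con 1ℚ := con 1ℚ :+ con 0ℚ :* u) refl (+ 1 / N))
    bernoulli (suc k) = begin
      1ℚ                                          ≤⟨ bernoulli k ⟩
      X + ℕ→ℚ k * u                               ≡⟨ solve 3 (λ u X c → X :+ c :* u := (con 1ℚ :- u) :* X :+ u :* X :+ c :* u) refl u X (ℕ→ℚ k) ⟩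
      y * X + u * X + ℕ→ℚ k * u                   ≤⟨ +-monoˡ-≤ (ℕ→ℚ k * u) (+-monoʳ-≤ (y * X) (*-monoˡ-≤-nonNeg u {{1/N-nonNeg N}} (pow≤1 k))) ⟩
      y * X + u * 1ℚ + ℕ→ℚ k * u                  ≡⟨ solve 3 (λ u Z c → Z :+ u :* con 1ℚ :+ c :* u := Z :+ (con 1ℚ :+ c) :* u) refl u (y * X) (ℕ→ℚ k) ⟩
      y * X + (1ℚ + ℕ→ℚ k) * u                    ≡⟨ cong (λ t → y * X + t * u) (ℕ→ℚ-+ 1 k) ⟨
      y * X + ℕ→ℚ (suc k) * u                     ∎
      where
      X = y ^ℚ k
      u = + 1 / N

    -- Up to index N/2 the powers damp the harmonic terms by at most a factor of two, so the series
    -- still grows like a harmonic sum there.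
    ½≤pow : ∀ k → k ℕ.+ k ℕ.≤ N → ½ ≤ y ^ℚ k
    ½≤pow k 2k≤N = begin
      ½                                                     ≡⟨ solve 1 (λ t → con ½ := con 1ℚ :+ :- (con ½ :* con 1ℚ)) refl ½ ⟩
      1ℚ - ½ * 1ℚ                                           ≡⟨ cong (λ t → 1ℚ - ½ * t) (N*1/N≡1 N) ⟨
      1ℚ - ½ * (ν * u)                                      ≤⟨ +-monoʳ-≤ 1ℚ (neg-antimono-≤ (*-monoˡ-≤-nonNeg ½ (*-monoʳ-≤-nonNeg u {{1/N-nonNeg N}} (ℕ→ℚ-mono 2k≤N)))) ⟩
      1ℚ - ½ * (ℕ→ℚ (k ℕ.+ k) * u)                          ≡⟨ cong (λ t → 1ℚ - ½ * (t * u)) (ℕ→ℚ-+ k k) ⟩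
      1ℚ - ½ * ((ℕ→ℚ k + ℕ→ℚ k) * u)                        ≤⟨ +-monoˡ-≤ _ (bernoulli k) ⟩
      X + ℕ→ℚ k * u - ½ * ((ℕ→ℚ k + ℕ→ℚ k) * u)             ≡⟨ solve 3 (λ X c u → X :+ c :* u :- con ½ :* ((c :+ c) :* u) := X) refl X (ℕ→ℚ k) u ⟩
      X                                                     ∎
      where
      X = y ^ℚ k
      u = + 1 / N

    -- Between a and 2 a lie a terms, each at least 1/2 · 1/(2 a), because 4 a ≤ N keeps the powers
    -- above 1/2. They add at least 1/4.
    4L-doubling : ∀ a .{{_ : NonZero a}} → (a ℕ.+ a) ℕ.+ (a ℕ.+ a) ℕ.≤ N → 1ℚ + ℕ→ℚ 4 * L a ≤ ℕ→ℚ 4 * L (a ℕ.+ a)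
    4L-doubling a@(suc p) 4a≤N = begin
      1ℚ + ℕ→ℚ 4 * L a                         ≡⟨ cong (_+ ℕ→ℚ 4 * L a) quarter ⟨
      ℕ→ℚ 4 * (α * (½ * r)) + ℕ→ℚ 4 * L a      ≡⟨ solve 3 (λ f t l → f :* t :+ f :* l := f :* (l :+ t)) refl (ℕ→ℚ 4) (α * (½ * r)) (L a) ⟩
      ℕ→ℚ 4 * (L a + α * (½ * r))              ≤⟨ *-monoˡ-≤-nonNeg (ℕ→ℚ 4) (L-block-≥ a a term≥) ⟩
      ℕ→ℚ 4 * L (a ℕ.+ a)                      ∎
      where
      m = p ℕ.+ a
      r = + 1 / suc m
      α = ℕ→ℚ a
      quarter : ℕ→ℚ 4 * (α * (½ * r)) ≡ 1ℚ
      quarter = trans (solve 2 (λ α r → con (ℕ→ℚ 4) :* (α :* (con ½ :* r)) := (α :+ α) :* r) refl α r)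
                      (trans (cong (_* r) (sym (ℕ→ℚ-+ a a))) (N*1/N≡1 (suc m)))
      term≥ : ∀ k → k ℕ.< suc m → ½ * r ≤ term k
      term≥ k k<1+m = begin
        ½ * r                        ≤⟨ *-monoˡ-≤-nonNeg ½ (1/-anti (ℕ.≤-pred k<1+m)) ⟩
        ½ * (+ 1 / suc k)            ≤⟨ *-monoʳ-≤-nonNeg (+ 1 / suc k) {{1/N-nonNeg (suc k)}} (½≤pow (suc k) (ℕ.≤-trans (ℕ.+-mono-≤ k<1+m k<1+m) 4a≤N)) ⟩
        y ^ℚ suc k * (+ 1 / suc k)   ∎

    -- Each of the i doublings gains 1/4; the last one starts at 2^(i-1) and needs four times that
    -- to be at most N, which is the hypothesis.
    i≤4*L[2^i] : ∀ i → 2 ℕ.^ suc i ℕ.≤ N → ℕ→ℚ i ≤ ℕ→ℚ 4 * L (2 ℕ.^ i)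
    i≤4*L[2^i] zero    _     = begin
      0ℚ                  ≡⟨ *-zeroʳ (ℕ→ℚ 4) ⟨
      ℕ→ℚ 4 * 0ℚ          ≤⟨ *-monoˡ-≤-nonNeg (ℕ→ℚ 4) (L-mono {0} {1} (ℕ.≤′-step ℕ.≤′-refl)) ⟩
      ℕ→ℚ 4 * L 1         ∎
    i≤4*L[2^i] (suc i) 4*2^i≤N = begin
      ℕ→ℚ (suc i)                    ≡⟨ ℕ→ℚ-+ 1 i ⟩
      1ℚ + ℕ→ℚ i                     ≤⟨ +-monoʳ-≤ 1ℚ (i≤4*L[2^i] i (ℕ.≤-trans (ℕ.m≤m+n (2 ℕ.^ suc i) _) 4*2^i≤N)) ⟩
      1ℚ + ℕ→ℚ 4 * L (2 ℕ.^ i)       ≤⟨ 4L-doubling (2 ℕ.^ i) {{ℕ.m^n≢0 2 i}} (subst (ℕ._≤ N) double 4*2^i≤N) ⟩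
      ℕ→ℚ 4 * L (2 ℕ.^ i ℕ.+ 2 ℕ.^ i) ≡⟨ cong (λ n → ℕ→ℚ 4 * L (2 ℕ.^ i ℕ.+ n)) (ℕ.+-identityʳ (2 ℕ.^ i)) ⟨
      ℕ→ℚ 4 * L (2 ℕ.^ suc i)        ∎
      where
      P = 2 ℕ.^ i
      double : 2 ℕ.^ suc (suc i) ≡ (P ℕ.+ P) ℕ.+ (P ℕ.+ P)
      double = trans (cong (λ n → (P ℕ.+ n) ℕ.+ ((P ℕ.+ n) ℕ.+ 0)) (ℕ.+-identityʳ P)) (cong ((P ℕ.+ P) ℕ.+_) (ℕ.+-identityʳ _))

    i≤4*logPartialSum : ∀ i n → 2 ℕ.^ suc i ℕ.≤ N → 2 ℕ.^ i ℕ.≤ n → ℕ→ℚ i ≤ ℕ→ℚ 4 * L n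
    i≤4*logPartialSum i n 2^[1+i]≤N 2^i≤n = ≤-trans (i≤4*L[2^i] i 2^[1+i]≤N) (*-monoˡ-≤-nonNeg (ℕ→ℚ 4) (L-mono (ℕ.≤⇒≤′ 2^i≤n)))

  -- The real bounds in dimension 2.

  0<fromℚ : ∀ {q} → 0ℚ < q → fromℕ 0 <ᴿ fromℚ q
  0<fromℚ {q} 0<q = q , 0<q , 0 , λ _ _ → ≤-reflexive (+-identityˡ q)

  ℕ→ℚ-pos : ∀ n .{{_ : NonZero n}} → 0ℚ < ℕ→ℚ n
  ℕ→ℚ-pos n = positive⁻¹ (ℕ→ℚ n) {{normalize-pos n 1}}

  1/N-pos : ∀ n .{{_ : NonZero n}} → 0ℚ < + 1 / n
  1/N-pos n = positive⁻¹ (+ 1 / n) {{normalize-pos 1 n}}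

  module _ (N : ℕ) .{{_ : NonZero N}} where

    N*log≤ : ∀ {J h} c .{{_ : NonZero c}} → N ℕ.≤ 2 ℕ.^ J → N ℕ.* (2 ℕ.+ J) ℕ.≤ c ℕ.* h →
      fromℚ (+ 1 / c) *ᴿ (fromℕ N *ᴿ log N) ≤ᴿ fromℕ h
    N*log≤ {J} {h} c N≤2^J bound δ 0<δ = 0 , λ n _ → begin
      u * (ℕ→ℚ N * logPartialSum N n)    ≤⟨ *-monoˡ-≤-nonNeg u (*-monoˡ-≤-nonNeg (ℕ→ℚ N) {{ℕ→ℚ-nonNeg N}} (logPartialSum≤ N J n N≤2^J)) ⟩
      u * (ℕ→ℚ N * ℕ→ℚ (2 ℕ.+ J))        ≡⟨ cong (u *_) (ℕ→ℚ-* N (2 ℕ.+ J)) ⟨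
      u * ℕ→ℚ (N ℕ.* (2 ℕ.+ J))          ≤⟨ *-monoˡ-≤-nonNeg u (ℕ→ℚ-mono bound) ⟩
      u * ℕ→ℚ (c ℕ.* h)                  ≡⟨ cong (u *_) (ℕ→ℚ-* c h) ⟩
      u * (ℕ→ℚ c * ℕ→ℚ h)                ≡⟨ solve 3 (λ u c h → u :* (c :* h) := (c :* u) :* h) refl u (ℕ→ℚ c) (ℕ→ℚ h) ⟩
      ℕ→ℚ c * u * ℕ→ℚ h                  ≡⟨ cong (_* ℕ→ℚ h) (N*1/N≡1 c) ⟩
      1ℚ * ℕ→ℚ h                         ≡⟨ *-identityˡ (ℕ→ℚ h) ⟩
      ℕ→ℚ h                              ≤⟨ p≤p+q (ℕ→ℚ h) (<⇒≤ 0<δ) ⟩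
      ℕ→ℚ h + δ                          ∎
      where
      open +-*-Solver
      u = + 1 / c
      instance u-nonNeg = 1/N-nonNeg c

    ≤N*log : ∀ {i h} c → 2 ℕ.^ suc i ℕ.≤ N → h ℕ.≤ c ℕ.* i ℕ.* N →
      fromℕ h ≤ᴿ fromℕ (c ℕ.* 4) *ᴿ (fromℕ N *ᴿ log N)
    -- Unlike the upper estimate of log N, which holds for every partial sum, the lower one needs
    -- the first 2^i terms.
    ≤N*log {i} {h} c 2^[1+i]≤N bound δ 0<δ = 2 ℕ.^ i , λ n n≥ →
      let ℓ = logPartialSum N n in begin
      ℕ→ℚ h                                 ≤⟨ ℕ→ℚ-mono bound ⟩
      ℕ→ℚ (c ℕ.* i ℕ.* N)                   ≡⟨ ℕ→ℚ-* (c ℕ.* i) N ⟩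
      ℕ→ℚ (c ℕ.* i) * ℕ→ℚ N                 ≡⟨ cong (_* ℕ→ℚ N) (ℕ→ℚ-* c i) ⟩
      ℕ→ℚ c * ℕ→ℚ i * ℕ→ℚ N                 ≤⟨ *-monoʳ-≤-nonNeg (ℕ→ℚ N) {{ℕ→ℚ-nonNeg N}} (*-monoˡ-≤-nonNeg (ℕ→ℚ c) {{ℕ→ℚ-nonNeg c}} (i≤4*logPartialSum N i n 2^[1+i]≤N n≥)) ⟩
      ℕ→ℚ c * (ℕ→ℚ 4 * ℓ) * ℕ→ℚ N           ≡⟨ solve 4 (λ c f l N → c :* (f :* l) :* N := c :* f :* (N :* l)) refl (ℕ→ℚ c) (ℕ→ℚ 4) ℓ (ℕ→ℚ N) ⟩
      ℕ→ℚ c * ℕ→ℚ 4 * (ℕ→ℚ N * ℓ)           ≡⟨ cong (_* (ℕ→ℚ N * ℓ)) (ℕ→ℚ-* c 4) ⟨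
      ℕ→ℚ (c ℕ.* 4) * (ℕ→ℚ N * ℓ)           ≤⟨ p≤p+q _ (<⇒≤ 0<δ) ⟩
      ℕ→ℚ (c ℕ.* 4) * (ℕ→ℚ N * ℓ) + δ       ∎
      where
      open +-*-Solver

  H2≍N*log : ∃₂ λ (c₁ c₂ : ℝ) → fromℕ 0 <ᴿ c₁ × fromℕ 0 <ᴿ c₂ ×
    ∃ λ (N₀ : ℕ) → ∀ (N : ℕ) .{{_ : NonZero N}} → N₀ ℕ.≤ N →
      (c₁ *ᴿ (fromℕ N *ᴿ log N) ≤ᴿ fromℕ (H 2 N)) ×
      (fromℕ (H 2 N) ≤ᴿ c₂ *ᴿ (fromℕ N *ᴿ log N))
  H2≍N*log = fromℚ (+ 1 / (4 ℕ.* 64 ℕ.* 7 ℕ.* 8)) , fromℕ (128 ℕ.* 4) , 0<fromℚ (1/N-pos (4 ℕ.* 64 ℕ.* 7 ℕ.* 8)) , 0<fromℚ (ℕ→ℚ-pos (128 ℕ.* 4)) ,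
    1024 , λ N 1024≤N → lower N (H2-lower N 1024≤N) , upper N (H2-upper N 1024≤N)
    where
    lower : ∀ N .{{_ : NonZero N}} → (∃ λ J → N ℕ.≤ 2 ℕ.^ J × N ℕ.* (2 ℕ.+ J) ℕ.≤ 4 ℕ.* 64 ℕ.* 7 ℕ.* 8 ℕ.* H 2 N) →
      fromℚ (+ 1 / (4 ℕ.* 64 ℕ.* 7 ℕ.* 8)) *ᴿ (fromℕ N *ᴿ log N) ≤ᴿ fromℕ (H 2 N)
    lower N (J , N≤2^J , bound) = N*log≤ N {J} {H 2 N} (4 ℕ.* 64 ℕ.* 7 ℕ.* 8) N≤2^J bound
    upper : ∀ N .{{_ : NonZero N}} → (∃ λ i → 2 ℕ.^ suc i ℕ.≤ N × H 2 N ℕ.≤ 128 ℕ.* i ℕ.* N) →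
      fromℕ (H 2 N) ≤ᴿ fromℕ (128 ℕ.* 4) *ᴿ (fromℕ N *ᴿ log N)
    upper N (i , 2^[1+i]≤N , bound) = ≤N*log N {i} {H 2 N} 128 2^[1+i]≤N bound

  -- Rational powers and the exponent 1 + ε.

  ^ℚ-distribʳ-* : ∀ k p q → (p * q) ^ℚ k ≡ p ^ℚ k * q ^ℚ k
  ^ℚ-distribʳ-* zero    p q = refl
  ^ℚ-distribʳ-* (suc k) p q = trans (cong (p * q *_) (^ℚ-distribʳ-* k p q))
    (solve 4 (λ p q x y → p :* q :* (x :* y) := p :* x :* (q :* y)) refl p q (p ^ℚ k) (q ^ℚ k))
    where open +-*-Solver

  ^ℚ-*-assoc : ∀ p m n → (p ^ℚ m) ^ℚ n ≡ p ^ℚ (n ℕ.* m)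
  ^ℚ-*-assoc p m zero    = refl
  ^ℚ-*-assoc p m (suc n) = trans (cong (p ^ℚ m *_) (^ℚ-*-assoc p m n)) (sym (^ℚ-distribˡ-+ m (n ℕ.* m)))
    where
    ^ℚ-distribˡ-+ : ∀ m n → p ^ℚ (m ℕ.+ n) ≡ p ^ℚ m * p ^ℚ n
    ^ℚ-distribˡ-+ zero    n = sym (*-identityˡ (p ^ℚ n))
    ^ℚ-distribˡ-+ (suc m) n = trans (cong (p *_) (^ℚ-distribˡ-+ m n)) (sym (*-assoc p (p ^ℚ m) (p ^ℚ n)))

  ^ℚ-nonNeg : ∀ {p} → 0ℚ ≤ p → ∀ n → NonNegative (p ^ℚ n)
  ^ℚ-nonNeg         0≤p zero    = _
  ^ℚ-nonNeg {p} 0≤p (suc n) = nonNeg*nonNeg⇒nonNeg p {{nonNegative 0≤p}} (p ^ℚ n) {{^ℚ-nonNeg 0≤p n}}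

  ^ℚ-mono-≤ : ∀ {p q} → 0ℚ ≤ p → p ≤ q → ∀ n → p ^ℚ n ≤ q ^ℚ n
  ^ℚ-mono-≤ _ _ zero = ≤-refl
  ^ℚ-mono-≤ {p} {q} 0≤p p≤q (suc n) = ≤-trans
    (*-monoʳ-≤-nonNeg (p ^ℚ n) {{^ℚ-nonNeg 0≤p n}} p≤q)
    (*-monoˡ-≤-nonNeg q {{nonNegative (≤-trans 0≤p p≤q)}} (^ℚ-mono-≤ 0≤p p≤q n))

  ^ℚ-mono-< : ∀ {p q} → 0ℚ ≤ p → p < q → ∀ n .{{_ : NonZero n}} → p ^ℚ n < q ^ℚ n
  ^ℚ-mono-< {p} {q} 0≤p p<q (suc n) = ≤-<-trans
    (*-monoˡ-≤-nonNeg p {{nonNegative 0≤p}} (^ℚ-mono-≤ 0≤p (<⇒≤ p<q) n))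
    (*-monoˡ-<-pos (q ^ℚ n) {{^ℚ-pos n}} p<q)
    where
    posq = positive (≤-<-trans 0≤p p<q)
    ^ℚ-pos : ∀ n → Positive (q ^ℚ n)
    ^ℚ-pos zero    = _
    ^ℚ-pos (suc n) = pos*pos⇒pos q {{posq}} (q ^ℚ n) {{^ℚ-pos n}}

  -- Replaces the extraction of roots: bounds with fractional exponents are proved between powers
  -- and then cancelled.
  ^ℚ-cancel-≤ : ∀ {p q} → 0ℚ ≤ q → ∀ n .{{_ : NonZero n}} → p ^ℚ n ≤ q ^ℚ n → p ≤ q
  ^ℚ-cancel-≤ 0≤q n pⁿ≤qⁿ = ≮⇒≥ λ q<p → <-irrefl refl (<-≤-trans (^ℚ-mono-< 0≤q q<p n) pⁿ≤qⁿ)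

  1+1/k≤r⇒ : ∀ {k r} .{{_ : NonZero k}} → 1ℚ + (+ 1 / k) ≤ r → suc k ℕ.* ↧ₙ r ℕ.≤ k ℕ.* ℤ.∣ ↥ r ∣
  1+1/k≤r⇒ {k@(suc _)} {r} 1+1/k≤r = clear r (begin
    ℕ→ℚ (suc k)                        ≡⟨ ℕ→ℚ-+ 1 k ⟩
    1ℚ + ℕ→ℚ k                         ≡⟨ cong (_+ ℕ→ℚ k) (N*1/N≡1 k) ⟨
    ℕ→ℚ k * (+ 1 / k) + ℕ→ℚ k          ≡⟨ solve 2 (λ k u → k :* u :+ k := k :* (con 1ℚ :+ u)) refl (ℕ→ℚ k) (+ 1 / k) ⟩
    ℕ→ℚ k * (1ℚ + (+ 1 / k))           ≤⟨ *-monoˡ-≤-nonNeg (ℕ→ℚ k) {{ℕ→ℚ-nonNeg k}} 1+1/k≤r ⟩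
    ℕ→ℚ k * r                          ∎)
    where
    open +-*-Solver
    clear : ∀ r → ℕ→ℚ (suc k) ≤ ℕ→ℚ k * r → suc k ℕ.* ↧ₙ r ℕ.≤ k ℕ.* ℤ.∣ ↥ r ∣
    clear r 1+k≤kr with ℚᵘ.drop-*≤* (ℚᵘ.≤-respˡ-≃ (toℚᵘ-ℕ→ℚ (suc k))
      (ℚᵘ.≤-respʳ-≃ (ℚᵘ.≃-trans (toℚᵘ-homo-* (ℕ→ℚ k) r) (ℚᵘ.*-congʳ {toℚᵘ r} (toℚᵘ-ℕ→ℚ k))) (toℚᵘ-mono-≤ 1+k≤kr)))
    clear (mkℚ (+ a) b-1 _)    _ | le = ℤ.drop‿+≤+ (subst₂ ℤ._≤_
      (cong (λ b → + suc k ℤ.* + b) (ℕ.+-identityʳ (suc b-1)))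
      (trans (ℤ.*-identityʳ (+ k ℤ.* + a)) (sym (ℤ.pos-* k a))) le)
    -- A negative numerator contradicts k r ≥ k + 1, so `∣ ↥ r ∣` is the numerator itself.
    clear (mkℚ (-[1+ a ]) b-1 _) _ | ()

  fromℕ-≤-fromℚ : ∀ {h q} (C : ℕ) → ℕ→ℚ h ≤ ℕ→ℚ C * q → fromℕ h ≤ᴿ fromℕ C *ᴿ fromℚ q
  fromℕ-≤-fromℚ {h} {q} C h≤Cq δ 0<δ = 0 , λ _ _ → ≤-trans h≤Cq (p≤p+q (ℕ→ℚ C * q) (<⇒≤ 0<δ))

  H≪N^[1+ε] : ∀ (d : ℕ) .{{_ : NonZero d}} (ε : ℝ) → fromℕ 0 <ᴿ ε →
    ∃ λ (C : ℝ) → fromℕ 0 <ᴿ C × ∀ (N : ℕ) .{{_ : NonZero N}} → H d N ≤ C · N ^ (fromℕ 1 +ᴿ ε)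
  H≪N^[1+ε] (suc d) ε (δ , 0<δ , n₀ , δ≤ε) =
    fromℕ C , 0<fromℚ (ℕ→ℚ-pos C {{H-constant≢0 d k}}) , bound
    where
    -- Choosing 1/k < δ, where δ is eventually a lower bound of ε, makes `C` depend on d and ε only.
    k-1 = proj₁ (archimedean 1 δ 0<δ)
    k = suc k-1
    1/k<δ : + 1 / k < δ
    1/k<δ = subst (_< δ) (*-identityˡ (+ 1 / k)) (proj₂ (archimedean 1 δ 0<δ) k-1 ℕ.≤-refl)
    C = H-constant d k
    bound : ∀ (N : ℕ) .{{_ : NonZero N}} → H (suc d) N ≤ fromℕ C · N ^ (fromℕ 1 +ᴿ ε)
    bound N q (0≤q , r , (δ′ , 0<δ′ , n₁ , 1+ε≤r) , N^a≤q^b) = fromℕ-≤-fromℚ {H (suc d) N} {q} C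
      -- Both sides are raised to the power k b, where the exponents become natural numbers and N^a
      -- ≤ q^b applies.
      (^ℚ-cancel-≤ 0≤Cq (k ℕ.* b) {{ℕ.m*n≢0 k b}} (begin
        h ^ℚ (k ℕ.* b)                                       ≡⟨ ℕ→ℚ-^ (H (suc d) N) (k ℕ.* b) ⟨
        ℕ→ℚ (H (suc d) N ℕ.^ (k ℕ.* b))                      ≤⟨ ℕ→ℚ-mono (H^[k*b]≤C^[k*b]*N^[a*k] d k N a b (1+1/k≤r⇒ {k} {r} 1+1/k≤r)) ⟩
        ℕ→ℚ (C ℕ.^ (k ℕ.* b) ℕ.* (N ℕ.^ a) ℕ.^ k)            ≡⟨ ℕ→ℚ-* (C ℕ.^ (k ℕ.* b)) ((N ℕ.^ a) ℕ.^ k) ⟩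
        ℕ→ℚ (C ℕ.^ (k ℕ.* b)) * ℕ→ℚ ((N ℕ.^ a) ℕ.^ k)        ≡⟨ cong₂ _*_ (ℕ→ℚ-^ C (k ℕ.* b)) (ℕ→ℚ-^ (N ℕ.^ a) k) ⟩
        ℕ→ℚ C ^ℚ (k ℕ.* b) * ℕ→ℚ (N ℕ.^ a) ^ℚ k              ≤⟨ *-monoˡ-≤-nonNeg (ℕ→ℚ C ^ℚ (k ℕ.* b)) {{^ℚ-nonNeg 0≤C (k ℕ.* b)}}
                                                                   (^ℚ-mono-≤ (nonNegative⁻¹ _ {{ℕ→ℚ-nonNeg (N ℕ.^ a)}}) N^a≤q^b k) ⟩
        ℕ→ℚ C ^ℚ (k ℕ.* b) * (q ^ℚ b) ^ℚ k                   ≡⟨ cong (ℕ→ℚ C ^ℚ (k ℕ.* b) *_) (^ℚ-*-assoc q b k) ⟩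
        ℕ→ℚ C ^ℚ (k ℕ.* b) * q ^ℚ (k ℕ.* b)                  ≡⟨ ^ℚ-distribʳ-* (k ℕ.* b) (ℕ→ℚ C) q ⟨
        (ℕ→ℚ C * q) ^ℚ (k ℕ.* b)                             ∎))
      where
      a = ℤ.∣ ↥ r ∣
      b = ↧ₙ r
      h = ℕ→ℚ (H (suc d) N)
      -- The bounds δ ≤ ε and 1 + ε < r hold from different indices on. At one common index they
      -- give an inequality between the rationals 1 + 1/k and r.
      n = n₀ ℕ.⊔ n₁
      0≤C : 0ℚ ≤ ℕ→ℚ C
      0≤C = nonNegative⁻¹ _ {{ℕ→ℚ-nonNeg C}}
      0≤Cq : 0ℚ ≤ ℕ→ℚ C * q
      0≤Cq = nonNegative⁻¹ _ {{nonNeg*nonNeg⇒nonNeg (ℕ→ℚ C) {{ℕ→ℚ-nonNeg C}} q {{nonNegative 0≤q}}}}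
      1+1/k≤r : 1ℚ + (+ 1 / k) ≤ r
      1+1/k≤r = begin
        1ℚ + (+ 1 / k)           ≤⟨ +-monoʳ-≤ 1ℚ (<⇒≤ 1/k<δ) ⟩
        1ℚ + δ                   ≡⟨ cong (λ t → 1ℚ + t) (+-identityˡ δ) ⟨
        1ℚ + (0ℚ + δ)            ≤⟨ +-monoʳ-≤ 1ℚ (δ≤ε n (ℕ.m≤m⊔n n₀ n₁)) ⟩
        1ℚ + seq ε n             ≤⟨ p≤p+q (1ℚ + seq ε n) (<⇒≤ 0<δ′) ⟩
        1ℚ + seq ε n + δ′        ≤⟨ 1+ε≤r n (ℕ.m≤n⊔m n₀ n₁) ⟩
        r                        ∎

open import Data.Nat using (ℕ; NonZero; _≤_)
open import Data.Product using (∃; ∃₂; _×_; _,_)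
open import Defs using (ℝ; _≤ᴿ_; _<ᴿ_; _+ᴿ_; _*ᴿ_; fromℕ; log; H; _≤_·_^_)

theorem1p7 : (∃₂ λ (c₁ c₂ : ℝ) → fromℕ 0 <ᴿ c₁ × fromℕ 0 <ᴿ c₂ ×
    ∃ λ (N₀ : ℕ) → ∀ (N : ℕ) .{{_ : NonZero N}} → N₀ ≤ N →
    (c₁ *ᴿ (fromℕ N *ᴿ log N) ≤ᴿ fromℕ (H 2 N)) ×
    (fromℕ (H 2 N) ≤ᴿ c₂ *ᴿ (fromℕ N *ᴿ log N)))
    ×
    (∀ (d : ℕ) .{{_ : NonZero d}} (ε : ℝ) → fromℕ 0 <ᴿ ε →
    ∃ λ (C : ℝ) → fromℕ 0 <ᴿ C ×
    ∀ (N : ℕ) .{{_ : NonZero N}} → H d N ≤ C · N ^ (fromℕ 1 +ᴿ ε))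
theorem1p7 = Rationals.H2≍N*log , Rationals.H≪N^[1+ε]
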